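{- Let $n\ge 1$ be an integer. The set of subgroups of $\mathbb{Z}^2$ of finite index $n$ is in bijection with the disjoint union of integer projective spaces $$\bigsqcup_{d\mid n,\ \frac nd=\square}\mathbb{PF}^1_d ,$$ where the union runs over the positive divisors $d$ of $n$ such that $n/d$ is a perfect square. Under this bijection (writing $M\in\mathbb{PF}^1_d$ to mean that the subgroup $M$ corresponds to an element of the component $\mathbb{PF}^1_d$) we have the following. \begin{enumerate} \item $M\in \mathbb{PF}^1_n$ if and only if there exists $(a,b)\in M$ with $\gcd(a,b)=1$, if and only if $\mathbb{Z}^2/M$ is a finite cyclic group. \item For $d\mid n$ with $n/d$ a perfect square, $M\in \mathbb{PF}^1_d$ if and only if $\mathbb{Z}^2/M\cong \mathbb{Z}/\sqrt{n/d}\,\mathbb{Z} \oplus \mathbb{Z}/\sqrt{nd}\,\mathbb{Z}$. \item The number of subgroups of $\mathbb{Z}^2$ of finite index $n$ is $\sigma(n)$, the sum of the positive divisors of $n$. \end{enumerate}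
   Context: For a positive integer $d$, $\mathbb{PF}^1_d$ is the quotient of $\{(a,b)\in\mathbb{Z}^2\mid \gcd(a,b)=1\}$ by the equivalence relation $(a,b)\sim(a',b')$ iff $d\mid ab'-ba'$. The symbol $\square$ denotes a perfect square. -}

module Defs where

open import Algebra.Bundles using (AbelianGroup)
import Algebra.Construct.DirectProduct as DirectProduct
import Algebra.Definitions.RawMonoid as RawMonoidDefinitions
open import Algebra.Morphism.Structures using (module GroupMorphisms)
import Algebra.Properties.AbelianGroup as AbelianGroupProperties
import Data.Fin.Properties as Fin
open import Data.Integer as ℤ using (ℤ; +_; -[1+_]; 1ℤ)
import Data.Integer.Divisibility as ℤD
import Data.Integer.Divisibility.Signed as Signed
open import Data.Integer.GCD using (gcd)
import Data.Integer.Properties as ℤP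
open import Data.Integer.Tactic.RingSolver using (solve-∀)
open import Data.List using (filter; map; sum; upTo)
open import Data.Nat using (ℕ; suc; _*_)
open import Data.Nat.Divisibility using (_∣_; _∣?_; quotient; divides)
import Data.Nat.GCD as ℕG
import Data.Nat.Properties as ℕP
import Data.Nat.Tactic.RingSolver as ℕSolver
open import Data.Product using (Σ; ∃; _×_; _,_)
open import Function.Bundles using (Bijection)
open import Level using (Level; 0ℓ; _⊔_) renaming (suc to lsuc)
open import Relation.Binary.Bundles using (Setoid)
open import Relation.Binary.PropositionalEquality
  using (_≡_; refl; sym; trans; cong; subst)
open import Relation.Unary using (Pred; _≐_)
import Relation.Unary.Properties as Unary

private
  variable
    a b ℓ ℓ₁ ℓ₂ p : Level

HasCardinality : Setoid a ℓ → ℕ → Set (a ⊔ ℓ)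
HasCardinality S m = Bijection S (Fin.≡-setoid m)

record Subgroup (A : AbelianGroup a ℓ) (p : Level) : Set (a ⊔ ℓ ⊔ lsuc p) where
  open AbelianGroup A
  field
    Member    : Pred Carrier p
    resp      : ∀ {x y} → x ≈ y → Member x → Member y
    ε-closed  : Member ε
    ∙-closed  : ∀ {x y} → Member x → Member y → Member (x ∙ y)
    ⁻¹-closed : ∀ {x} → Member x → Member (x ⁻¹)

open Subgroup public using (Member)

-- The quotient has the same carrier, with x ≈ y meaning that x - y lies in M.
infixl 7 _/ᴳ_
_/ᴳ_ : (A : AbelianGroup a ℓ) → Subgroup A p → AbelianGroup a p
_/ᴳ_ {p = p} A M = record
  { Carrier = Carrier
  ; _≈_ = _∼_
  ; _∙_ = _∙_
  ; ε   = ε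
  ; _⁻¹ = _⁻¹
  ; isAbelianGroup = record
    { isGroup = record
      { isMonoid = record
        { isSemigroup = record
          { isMagma = record
            { isEquivalence = record
              { refl  = ≈⇒∼ A.refl
              ; sym   = λ {x} {y} r → resp (⁻¹-anti-homo‿- x y) (⁻¹-closed r)
              ; trans = λ {x} {y} {z} r s → resp (telescope x y z) (∙-closed r s)
              }
            ; ∙-cong = λ {x} {y} {u} {v} r s → resp (rearrange x y u v) (∙-closed r s)
            }
          ; assoc = λ x y z → ≈⇒∼ (assoc x y z)
          }
        ; identity = (λ x → ≈⇒∼ (identityˡ x)) , (λ x → ≈⇒∼ (identityʳ x))
        }
      ; inverse = (λ x → ≈⇒∼ (inverseˡ x)) , (λ x → ≈⇒∼ (inverseʳ x))
      ; ⁻¹-cong = λ {x} {y} r → resp (A.sym (⁻¹-∙-comm x (y ⁻¹))) (⁻¹-closed r)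
      }
    ; comm = λ x y → ≈⇒∼ (comm x y)
    }
  }
  where
  module A = AbelianGroup A
  open A using (Carrier; _≈_; _∙_; ε; _⁻¹; _-_; assoc; identityˡ; identityʳ;
                inverseˡ; inverseʳ; comm; ∙-cong; ∙-congˡ; ∙-congʳ)
  open AbelianGroupProperties A
  open Subgroup M using (resp; ε-closed; ∙-closed; ⁻¹-closed)
  open import Relation.Binary.Reasoning.Setoid A.setoid

  _∼_ : Carrier → Carrier → Set p
  x ∼ y = Member M (x - y)

  ≈⇒∼ : ∀ {x y} → x ≈ y → x ∼ y
  ≈⇒∼ x≈y = resp (A.sym (x≈y⇒x∙y⁻¹≈ε x≈y)) ε-closed

  telescope : ∀ x y z → (x - y) ∙ (y - z) ≈ x - z
  telescope x y z = begin
    (x - y) ∙ (y ∙ z ⁻¹)  ≈⟨ assoc (x - y) y (z ⁻¹) ⟨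
    (x - y) ∙ y ∙ z ⁻¹    ≈⟨ ∙-congʳ (//-rightDividesˡ y x) ⟩
    x ∙ z ⁻¹              ∎

  rearrange : ∀ x y u v → (x - y) ∙ (u - v) ≈ (x ∙ u) - (y ∙ v)
  rearrange x y u v = begin
    (x ∙ y ⁻¹) ∙ (u ∙ v ⁻¹)  ≈⟨ assoc x (y ⁻¹) (u ∙ v ⁻¹) ⟩
    x ∙ (y ⁻¹ ∙ (u ∙ v ⁻¹))  ≈⟨ ∙-congˡ (assoc (y ⁻¹) u (v ⁻¹)) ⟨
    x ∙ (y ⁻¹ ∙ u ∙ v ⁻¹)    ≈⟨ ∙-congˡ (∙-congʳ (comm (y ⁻¹) u)) ⟩
    x ∙ (u ∙ y ⁻¹ ∙ v ⁻¹)    ≈⟨ ∙-congˡ (assoc u (y ⁻¹) (v ⁻¹)) ⟩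
    x ∙ (u ∙ (y ⁻¹ ∙ v ⁻¹))  ≈⟨ assoc x u (y ⁻¹ ∙ v ⁻¹) ⟨
    x ∙ u ∙ (y ⁻¹ ∙ v ⁻¹)    ≈⟨ ∙-congˡ (⁻¹-∙-comm y v) ⟩
    x ∙ u ∙ (y ∙ v) ⁻¹       ∎

infix 4 _≅_
_≅_ : AbelianGroup a ℓ₁ → AbelianGroup b ℓ₂ → Set (a ⊔ b ⊔ ℓ₁ ⊔ ℓ₂)
A ≅ B = ∃ λ f → IsGroupIsomorphism f
  where open GroupMorphisms (AbelianGroup.rawGroup A) (AbelianGroup.rawGroup B)

infixr 6 _⊕_
_⊕_ : AbelianGroup a ℓ₁ → AbelianGroup b ℓ₂ → AbelianGroup (a ⊔ b) (ℓ₁ ⊔ ℓ₂)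
_⊕_ = DirectProduct.abelianGroup

module _ (A : AbelianGroup a ℓ) where
  open AbelianGroup A
  open RawMonoidDefinitions rawMonoid using () renaming (_×_ to _×ℕ_)

  infixr 8 _×ℤ_
  _×ℤ_ : ℤ → Carrier → Carrier
  (+ k)    ×ℤ x = k ×ℕ x
  -[1+ k ] ×ℤ x = (suc k ×ℕ x) ⁻¹

  Cyclic : Set (a ⊔ ℓ)
  Cyclic = ∃ λ g → ∀ x → ∃ λ k → x ≈ k ×ℤ g

  Finite : Set (a ⊔ ℓ)
  Finite = ∃ λ m → HasCardinality setoid m

  FiniteCyclic : Set (a ⊔ ℓ)
  FiniteCyclic = Finite × Cyclic

ℤ⁺ : AbelianGroup 0ℓ 0ℓ
ℤ⁺ = ℤP.+-0-abelianGroup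

ℤ² : AbelianGroup 0ℓ 0ℓ
ℤ² = ℤ⁺ ⊕ ℤ⁺

multiples : ℕ → Subgroup ℤ⁺ 0ℓ
multiples m = record
  { Member    = λ x → + m ℤD.∣ x
  ; resp      = λ { refl d → d }
  ; ε-closed  = divides 0 refl
  ; ∙-closed  = λ {x} {y} d e → Signed.∣⇒∣ᵤ {+ m} {x ℤ.+ y}
                  (Signed.∣m∣n⇒∣m+n (Signed.∣ᵤ⇒∣ {+ m} {x} d) (Signed.∣ᵤ⇒∣ {+ m} {y} e))
  ; ⁻¹-closed = λ {x} d → Signed.∣⇒∣ᵤ {+ m} {ℤ.- x} (Signed.∣m⇒∣-m (Signed.∣ᵤ⇒∣ {+ m} {x} d))
  }

ℤ/_ℤ : ℕ → AbelianGroup 0ℓ 0ℓ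
ℤ/ m ℤ = ℤ⁺ /ᴳ multiples m

-- A subgroup of finite index has decidable membership, as it is the fibre of a
-- map to a finite set, so predicates valued in Set already give every one.
FiniteIndexSubgroup : ℕ → Set₁
FiniteIndexSubgroup n =
  Σ (Subgroup ℤ² 0ℓ) λ M → HasCardinality (AbelianGroup.setoid (ℤ² /ᴳ M)) n

-- Equality is equality of the underlying sets of elements; the witness that the
-- index is n is ignored.
subgroupsOfIndex : ℕ → Setoid (lsuc 0ℓ) 0ℓ
subgroupsOfIndex n = record
  { Carrier = FiniteIndexSubgroup n
  ; _≈_ = λ (M , _) (N , _) → Member M ≐ Member N
  ; isEquivalence = record
    { refl  = Unary.≐-refl
    ; sym   = Unary.≐-sym
    ; trans = Unary.≐-trans
    }
  }

Primitive : Set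
Primitive = Σ (ℤ × ℤ) λ (a , b) → gcd a b ≡ 1ℤ

PF∼ : ℕ → Primitive → Primitive → Set
PF∼ d ((a , b) , _) ((a′ , b′) , _) = + d ℤD.∣ a ℤ.* b′ ℤ.- b ℤ.* a′

PF¹ : ℕ → Setoid 0ℓ 0ℓ
PF¹ d = record
  { Carrier = Primitive
  ; _≈_ = PF∼ d
  ; isEquivalence = record
    { refl  = λ {x} → ∼-refl {x}
    ; sym   = λ {x} {y} → ∼-sym {x} {y}
    ; trans = λ {x} {y} {z} → ∼-trans {x} {y} {z}
    }
  }
  where
  ∼-refl : ∀ {x} → PF∼ d x x
  ∼-refl {(a , b) , _} = subst (+ d ℤD.∣_) (sym (zero-det a b)) (divides 0 refl)
    where
    zero-det : ∀ a b → a ℤ.* b ℤ.- b ℤ.* a ≡ + 0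
    zero-det = solve-∀

  ∼-sym : ∀ {x y} → PF∼ d x y → PF∼ d y x
  ∼-sym {(a , b) , _} {(a′ , b′) , _} r =
    subst (d ∣_) (trans (sym (ℤP.∣-i∣≡∣i∣ (a ℤ.* b′ ℤ.- b ℤ.* a′)))
                        (cong ℤ.∣_∣ (neg-det a b a′ b′))) r
    where
    neg-det : ∀ a b a′ b′ → ℤ.- (a ℤ.* b′ ℤ.- b ℤ.* a′) ≡ a′ ℤ.* b ℤ.- b′ ℤ.* a
    neg-det = solve-∀

  -- d divides both a′D and b′D, where D = ab″ - ba″, and a′, b′ are coprime.
  ∼-trans : ∀ {x y z} → PF∼ d x y → PF∼ d y z → PF∼ d x z
  ∼-trans {(a , b) , _} {(a′ , b′) , prim} {(a″ , b″) , _} r s =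
    cancel (combine a a″ (left a b a′ b′ a″ b″)) (combine b b″ (right a b a′ b′ a″ b″))
    where
    D E F : ℤ
    D = a ℤ.* b″ ℤ.- b ℤ.* a″
    E = a ℤ.* b′ ℤ.- b ℤ.* a′
    F = a′ ℤ.* b″ ℤ.- b′ ℤ.* a″

    left : ∀ a b a′ b′ a″ b″ →
           a ℤ.* (a′ ℤ.* b″ ℤ.- b′ ℤ.* a″) ℤ.+ a″ ℤ.* (a ℤ.* b′ ℤ.- b ℤ.* a′)
           ≡ a′ ℤ.* (a ℤ.* b″ ℤ.- b ℤ.* a″)
    left = solve-∀

    right : ∀ a b a′ b′ a″ b″ →
            b ℤ.* (a′ ℤ.* b″ ℤ.- b′ ℤ.* a″) ℤ.+ b″ ℤ.* (a ℤ.* b′ ℤ.- b ℤ.* a′)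
            ≡ b′ ℤ.* (a ℤ.* b″ ℤ.- b ℤ.* a″)
    right = solve-∀

    combine : ∀ u v {w} → u ℤ.* F ℤ.+ v ℤ.* E ≡ w → + d ℤD.∣ w
    combine u v refl = Signed.∣⇒∣ᵤ {+ d} {u ℤ.* F ℤ.+ v ℤ.* E}
      (Signed.∣m∣n⇒∣m+n (Signed.∣n⇒∣m*n u (Signed.∣ᵤ⇒∣ {+ d} {F} s))
                        (Signed.∣n⇒∣m*n v (Signed.∣ᵤ⇒∣ {+ d} {E} r)))

    cancel : + d ℤD.∣ a′ ℤ.* D → + d ℤD.∣ b′ ℤ.* D → + d ℤD.∣ D
    cancel p q = subst (d ∣_) gcd-scaled (ℕG.gcd-greatest (scaled a′ p) (scaled b′ q))
      where
      k = ℤ.∣ D ∣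

      scaled : ∀ c → + d ℤD.∣ c ℤ.* D → d ∣ k * ℤ.∣ c ∣
      scaled c = subst (d ∣_) (trans (ℤP.abs-* c D) (ℕP.*-comm ℤ.∣ c ∣ k))

      gcd-scaled : ℕG.gcd (k * ℤ.∣ a′ ∣) (k * ℤ.∣ b′ ∣) ≡ k
      gcd-scaled = trans (sym (ℕG.c*gcd[m,n]≡gcd[cm,cn] k ℤ.∣ a′ ∣ ℤ.∣ b′ ∣))
                         (trans (cong (k *_) (ℤP.+-injective prim)) (ℕP.*-identityʳ k))

record IsSquare (m : ℕ) : Set where
  constructor square
  field
    root   : ℕ
    root²≡ : root * root ≡ m

open IsSquare public using (root)

-- √(nd) = √(n/d) · d.
n*d-isSquare : ∀ {n d} (d∣n : d ∣ n) → IsSquare (quotient d∣n) → IsSquare (n * d)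
n*d-isSquare {d = d} (divides _ refl) (square r refl) = square (r * d) (lemma r d)
  where
  lemma : ∀ r d → r * d * (r * d) ≡ r * r * d * d
  lemma = ℕSolver.solve-∀

record ⨆PF¹-Carrier (n : ℕ) : Set where
  field
    component : ℕ
    divisor   : component ∣ n
    isSquare  : IsSquare (quotient divisor)
    point     : Setoid.Carrier (PF¹ component)

open ⨆PF¹-Carrier public using (component)

-- For n ≥ 1 the divisor d is positive, and quotient d∣n is n/d.
⨆PF¹ : ℕ → Setoid 0ℓ 0ℓ
⨆PF¹ n = record
  { Carrier = ⨆PF¹-Carrier n
  ; _≈_ = λ x y → component x ≡ component y × PF∼ (component x) (point x) (point y)
  ; isEquivalence = record
    { refl  = λ {x} → refl , S.refl (component x) {point x}
    ; sym   = λ {x} {y} (e , r) →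
        sym e , subst (λ d → PF∼ d (point y) (point x)) e
                  (S.sym (component x) {point x} {point y} r)
    ; trans = λ {x} {y} {z} (e , r) (f , s) →
        trans e f , S.trans (component x) {point x} {point y} {point z} r
                      (subst (λ d → PF∼ d (point y) (point z)) (sym e) s)
    }
  }
  where
  open ⨆PF¹-Carrier using (point)
  module S d = Setoid (PF¹ d)

σ : ℕ → ℕ
σ n = sum (filter (_∣? n) (map suc (upTo n)))

{-# OPTIONS --safe #-}

-- The point p of PF¹ d corresponds to the lattice M = { v : r ∣ v, rd ∣ det(p , v) }, where n = r²d.
-- Completing p to a basis p, q with det(p , q) = 1, the coordinates (det(v , q) , det(p , v)) of v
-- identify ℤ²/M with ℤ/r ⊕ ℤ/rd; r is the content of M, and rd is the exponent of the quotient.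
-- Conversely, a subgroup of index n is spanned by unique vectors (c , b) and (0 , a) with ca = n and
-- 0 ≤ b < a, which counts the subgroups. If r = gcd(a , b , c), it contains r times a primitive
-- vector (c/r , b/r + t a/r), and this gives the point p.
module Submission where

import Algebra.Definitions.RawMonoid as RawMonoidDefinitions
import Algebra.Properties.Monoid.Mult as Mult
open import Algebra.Bundles using (AbelianGroup)
open import Algebra.Morphism.Structures using (module GroupMorphisms)
open import Defs
open import Data.Empty using (⊥-elim)
open import Data.Fin using (Fin; toℕ; fromℕ<; combine; remQuot; _↑ˡ_; _↑ʳ_; splitAt)
import Data.Fin.Properties as Fin
open import Data.Integer using (ℤ; 1ℤ)
open import Data.Integer as ℤ using (+_; 0ℤ)
import Data.Integer.Divisibility as ℤD
open import Data.Integer.Divisibility.Signed as Signed using (∣ᵤ⇒∣; ∣⇒∣ᵤ)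
open import Data.Integer.DivMod using (_%ℕ_; _/ℕ_; n%ℕd<d; a≡a%ℕn+[a/ℕn]*n)
open import Data.Integer.GCD using (gcd)
import Data.Integer.Properties as ℤP
open import Data.Integer.Tactic.RingSolver using (solve-∀)
open import Data.List using (List; _∷_; filter; map; upTo)
open import Data.List.Membership.Propositional using (_∈_)
open import Data.List.Membership.Propositional.Properties using (∈-filter⁺; ∈-filter⁻; ∈-map⁺; ∈-upTo⁺)
import Data.List.Membership.Setoid.Properties as Membership
open import Data.List.Relation.Unary.Any using (here; there)
open import Data.List.Relation.Unary.Unique.Propositional using (Unique)
import Data.List.Relation.Unary.Unique.Propositional.Properties as Unique
open import Data.Nat using (ℕ; NonZero; _*_)
import Data.Nat as ℕ
open import Data.Nat.Coprimality as Coprimality using (Coprime; coprime-Bézout; gcd≡1⇒coprime)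
open import Data.Nat.Divisibility using (_∣_; quotient)
import Data.Nat.Divisibility as ℕD
open import Data.Nat.GCD as ℕG using (module Bézout)
open import Data.Nat.Induction using (<-wellFounded)
open import Data.Nat.ListAction using (sum)
import Data.Nat.Properties as ℕP
import Data.Nat.Tactic.RingSolver as ℕSolver
open import Data.Product using (Σ; ∃; ∃₂; _×_; _,_; proj₁; proj₂)
open import Data.Product.Function.NonDependent.Setoid using (_×-inverse_)
open import Data.Sum using (inj₁; inj₂)
open import Function.Base using (_∘_)
open import Function.Bundles using (Bijection; Inverse; _⇔_; mk⇔)
import Function.Construct.Composition as Compose
open import Function.Construct.Composition using (_⇔-∘_)
open import Function.Construct.Symmetry using (⇔-sym)
open import Function.Properties.Inverse using (Inverse⇒Bijection)
open import Induction.WellFounded using (Acc; acc)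
open import Level using (0ℓ)
open import Relation.Binary.Bundles using (Setoid)
open import Relation.Binary.Core using (Rel)
open import Relation.Binary.Definitions using (tri<; tri≈; tri>)
open import Relation.Binary.PropositionalEquality
  using (_≡_; refl; sym; trans; cong; cong₂; subst; subst₂; setoid; module ≡-Reasoning)
import Relation.Binary.Reasoning.Setoid as ≈-Reasoning
open import Relation.Nullary using (yes; no)
open import Relation.Nullary.Decidable using (map′)
open import Relation.Unary using (Pred; _≐_; _⊆_; Decidable)
open import Relation.Unary.Properties using (≐-sym; ≐-trans)

-- The spanning vectors must be found by a terminating search. Finite index makes membership
-- decidable and gives every vector a positive multiple in the subgroup; these supply the test and
-- the starting point of a descent to a least positive element. The search yields some product
-- `c * a` that is not visibly the index: it is identified with `n` only afterwards, by counting the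
-- quotient through the lattice form. Distinct classes give distinct subgroups because `r p` lies in
-- its own lattice: as a test vector it determines `r`, hence `d` from `n = r²d`, and then the class
-- of `p` through a determinant. The integer `t` exists because `a/r`, `b/r`, `c/r` have no common
-- factor: it is chosen divisible by the right primes of `c/r`, by way of the part of `c/r` prime to
-- `b/r`.

-- Determinants and unimodular bases of `ℤ²`.

det : ℤ × ℤ → ℤ × ℤ → ℤ
det (a , b) (x , y) = a ℤ.* y ℤ.- b ℤ.* x

det-self : ∀ v → det v v ≡ 0ℤ
det-self (x , y) = lemma x y
  where
  lemma : ∀ x y → x ℤ.* y ℤ.- y ℤ.* x ≡ 0ℤ
  lemma = solve-∀

det-swap : ∀ v w → det v w ≡ ℤ.- det w v
det-swap (x , y) (x′ , y′) = lemma x y x′ y′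
  where
  lemma : ∀ x y x′ y′ → x ℤ.* y′ ℤ.- y ℤ.* x′ ≡ ℤ.- (x′ ℤ.* y ℤ.- y′ ℤ.* x)
  lemma = solve-∀

det-zeroʳ : ∀ v → det v (0ℤ , 0ℤ) ≡ 0ℤ
det-zeroʳ (a , b) = lemma a b
  where
  lemma : ∀ a b → a ℤ.* 0ℤ ℤ.- b ℤ.* 0ℤ ≡ 0ℤ
  lemma = solve-∀

det-zeroˡ : ∀ v → det (0ℤ , 0ℤ) v ≡ 0ℤ
det-zeroˡ v = trans (det-swap (0ℤ , 0ℤ) v) (cong ℤ.-_ (det-zeroʳ v))

infixl 7 _·_
_·_ : ℤ → ℤ × ℤ → ℤ × ℤ
k · (x , y) = k ℤ.* x , k ℤ.* y

infixl 6 _⊞_ _⊟_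
_⊞_ _⊟_ : ℤ × ℤ → ℤ × ℤ → ℤ × ℤ
(x , y) ⊞ (x′ , y′) = x ℤ.+ x′ , y ℤ.+ y′
(x , y) ⊟ (x′ , y′) = x ℤ.- x′ , y ℤ.- y′

⊖_ : ℤ × ℤ → ℤ × ℤ
⊖ (x , y) = ℤ.- x , ℤ.- y

det-⊞ʳ : ∀ u v w → det u (v ⊞ w) ≡ det u v ℤ.+ det u w
det-⊞ʳ (a , b) (x , y) (x′ , y′) = lemma a b x y x′ y′
  where
  lemma : ∀ a b x y x′ y′ → a ℤ.* (y ℤ.+ y′) ℤ.- b ℤ.* (x ℤ.+ x′)
          ≡ (a ℤ.* y ℤ.- b ℤ.* x) ℤ.+ (a ℤ.* y′ ℤ.- b ℤ.* x′)
  lemma = solve-∀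

det-⊞ˡ : ∀ u v w → det (v ⊞ w) u ≡ det v u ℤ.+ det w u
det-⊞ˡ (a , b) (x , y) (x′ , y′) = lemma a b x y x′ y′
  where
  lemma : ∀ a b x y x′ y′ → (x ℤ.+ x′) ℤ.* b ℤ.- (y ℤ.+ y′) ℤ.* a
          ≡ (x ℤ.* b ℤ.- y ℤ.* a) ℤ.+ (x′ ℤ.* b ℤ.- y′ ℤ.* a)
  lemma = solve-∀

det-⊖ʳ : ∀ u v → det u (⊖ v) ≡ ℤ.- det u v
det-⊖ʳ (a , b) (x , y) = lemma a b x y
  where
  lemma : ∀ a b x y → a ℤ.* ℤ.- y ℤ.- b ℤ.* ℤ.- x ≡ ℤ.- (a ℤ.* y ℤ.- b ℤ.* x)
  lemma = solve-∀

det-⊖ˡ : ∀ u v → det (⊖ v) u ≡ ℤ.- det v u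
det-⊖ˡ (a , b) (x , y) = lemma a b x y
  where
  lemma : ∀ a b x y → ℤ.- x ℤ.* b ℤ.- ℤ.- y ℤ.* a ≡ ℤ.- (x ℤ.* b ℤ.- y ℤ.* a)
  lemma = solve-∀

det-⊟ʳ : ∀ u v w → det u (v ⊟ w) ≡ det u v ℤ.- det u w
det-⊟ʳ u v w = trans (det-⊞ʳ u v (⊖ w)) (cong (λ z → det u v ℤ.+ z) (det-⊖ʳ u w))

det-⊟ˡ : ∀ u v w → det (v ⊟ w) u ≡ det v u ℤ.- det w u
det-⊟ˡ u v w = trans (det-⊞ˡ u v (⊖ w)) (cong (λ z → det v u ℤ.+ z) (det-⊖ˡ u w))

det-·ʳ : ∀ k u v → det u (k · v) ≡ k ℤ.* det u v
det-·ʳ k (a , b) (x , y) = lemma k a b x y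
  where
  lemma : ∀ k a b x y → a ℤ.* (k ℤ.* y) ℤ.- b ℤ.* (k ℤ.* x) ≡ k ℤ.* (a ℤ.* y ℤ.- b ℤ.* x)
  lemma = solve-∀

det-·ˡ : ∀ k u v → det (k · v) u ≡ k ℤ.* det v u
det-·ˡ k (a , b) (x , y) = lemma k a b x y
  where
  lemma : ∀ k a b x y → (k ℤ.* x) ℤ.* b ℤ.- (k ℤ.* y) ℤ.* a ≡ k ℤ.* (x ℤ.* b ℤ.- y ℤ.* a)
  lemma = solve-∀

-- Cramer's rule in a basis of determinant 1.
expand : ∀ p q v → det p q ≡ 1ℤ → det v q · p ⊞ det p v · q ≡ v
expand (a , b) (a′ , b′) (x , y) pq≡1 =
  cong₂ _,_ (trans (first a b a′ b′ x y) (times-one x)) (trans (second a b a′ b′ x y) (times-one y))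
  where
  first : ∀ a b a′ b′ x y → (x ℤ.* b′ ℤ.- y ℤ.* a′) ℤ.* a ℤ.+ (a ℤ.* y ℤ.- b ℤ.* x) ℤ.* a′
          ≡ x ℤ.* (a ℤ.* b′ ℤ.- b ℤ.* a′)
  first = solve-∀

  second : ∀ a b a′ b′ x y → (x ℤ.* b′ ℤ.- y ℤ.* a′) ℤ.* b ℤ.+ (a ℤ.* y ℤ.- b ℤ.* x) ℤ.* b′
           ≡ y ℤ.* (a ℤ.* b′ ℤ.- b ℤ.* a′)
  second = solve-∀

  times-one : ∀ z → z ℤ.* det (a , b) (a′ , b′) ≡ z
  times-one z = trans (cong (z ℤ.*_) pq≡1) (ℤP.*-identityʳ z)

coprime⇒combination : ∀ {m n} → Coprime m n → ∃₂ λ x y → x ℤ.* + m ℤ.- y ℤ.* + n ≡ 1ℤ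
coprime⇒combination {m} {n} c = signed (coprime-Bézout c)
  where
  open ≡-Reasoning
  cancel : ∀ v → (1ℤ ℤ.+ v) ℤ.- v ≡ 1ℤ
  cancel = solve-∀

  swap : ∀ x y m n → ℤ.- x ℤ.* m ℤ.- ℤ.- y ℤ.* n ≡ y ℤ.* n ℤ.- x ℤ.* m
  swap = solve-∀

  cast : ∀ x k y l → 1 ℕ.+ y * l ≡ x * k → + x ℤ.* + k ℤ.- + y ℤ.* + l ≡ 1ℤ
  cast x k y l eq = begin
    + x ℤ.* + k ℤ.- + y ℤ.* + l    ≡⟨ cong₂ ℤ._-_ (ℤP.pos-* x k) (ℤP.pos-* y l) ⟨
    + (x * k) ℤ.- + (y * l)        ≡⟨ cong (λ z → + z ℤ.- + (y * l)) eq ⟨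
    1ℤ ℤ.+ + (y * l) ℤ.- + (y * l) ≡⟨ cancel (+ (y * l)) ⟩
    1ℤ                             ∎

  signed : Bézout.Identity 1 m n → ∃₂ λ x y → x ℤ.* + m ℤ.- y ℤ.* + n ≡ 1ℤ
  signed (Bézout.+- x y eq) = + x , + y , cast x m y n eq
  signed (Bézout.-+ x y eq) =
    ℤ.- + x , ℤ.- + y , trans (swap (+ x) (+ y) (+ m) (+ n)) (cast y n x m eq)

-- Bézout for the absolute values; the factors `ε` and `η` with `|a| = ε a` and `|b| = η b` are
-- moved into the coefficients, which become the second basis vector.
gcd≡1⇒det≡1 : ∀ a b → gcd a b ≡ 1ℤ → ∃ λ q → det (a , b) q ≡ 1ℤ
gcd≡1⇒det≡1 a b gcd≡1
  with Signed.divides ε |a|≡εa ← Signed.m∣∣m∣ {a}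
     | Signed.divides η |b|≡ηb ← Signed.m∣∣m∣ {b}
  with x , y , eq ← coprime⇒combination (gcd≡1⇒coprime (ℤP.+-injective gcd≡1)) =
  (y ℤ.* η , x ℤ.* ε) ,
  trans (regroup a b x y ε η)
        (trans (sym (cong₂ (λ u v → x ℤ.* u ℤ.- y ℤ.* v) |a|≡εa |b|≡ηb)) eq)
  where
  regroup : ∀ a b x y ε η → a ℤ.* (x ℤ.* ε) ℤ.- b ℤ.* (y ℤ.* η) ≡ x ℤ.* (ε ℤ.* a) ℤ.- y ℤ.* (η ℤ.* b)
  regroup = solve-∀

-- Lattices and the structure of their quotients.

-- For s = r d this is r { v : d ∣ det p v }, the subgroup corresponding to the class of p in PF¹ d.
Lattice : ℕ → ℕ → ℤ × ℤ → Pred (ℤ × ℤ) 0ℓ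
Lattice r s p v = (+ r Signed.∣ proj₁ v × + r Signed.∣ proj₂ v) × + s Signed.∣ det p v

lattice : ℕ → ℕ → ℤ × ℤ → Subgroup ℤ² 0ℓ
lattice r s p = record
  { Member    = Lattice r s p
  ; resp      = λ { (refl , refl) m → m }
  ; ε-closed  = (divides-zero , divides-zero) , subst (+ s Signed.∣_) (sym (det-zeroʳ p)) divides-zero
  ; ∙-closed  = λ { {v} {w} ((a , b) , c) ((a′ , b′) , c′) →
      (Signed.∣m∣n⇒∣m+n a a′ , Signed.∣m∣n⇒∣m+n b b′) ,
      subst (+ s Signed.∣_) (sym (det-⊞ʳ p v w)) (Signed.∣m∣n⇒∣m+n c c′) }
  ; ⁻¹-closed = λ { {v} ((a , b) , c) →
      (Signed.∣m⇒∣-m a , Signed.∣m⇒∣-m b) ,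
      subst (+ s Signed.∣_) (sym (det-⊖ʳ p v)) (Signed.∣m⇒∣-m c) }
  }
  where
  divides-zero : ∀ {k} → k Signed.∣ 0ℤ
  divides-zero = Signed.divides 0ℤ refl

∣-combination : ∀ {k x y} a b → k Signed.∣ x → k Signed.∣ y → k Signed.∣ x ℤ.* a ℤ.+ y ℤ.* b
∣-combination a b k∣x k∣y = Signed.∣m∣n⇒∣m+n (Signed.∣m⇒∣m*n a k∣x) (Signed.∣m⇒∣m*n b k∣y)

∣-det : ∀ {k x y} w → k Signed.∣ x → k Signed.∣ y → k Signed.∣ det w (x , y)
∣-det (a , b) k∣x k∣y = Signed.∣m∣n⇒∣m-n (Signed.∣n⇒∣m*n a k∣y) (Signed.∣n⇒∣m*n b k∣x)

∣-detˡ : ∀ {k x y} w → k Signed.∣ x → k Signed.∣ y → k Signed.∣ det (x , y) w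
∣-detˡ {k} {x} {y} w k∣x k∣y = subst (k Signed.∣_) (sym (det-swap (x , y) w)) (Signed.∣m⇒∣-m (∣-det w k∣x k∣y))

module _ {r s : ℕ} (p q : ℤ × ℤ) (pq≡1 : det p q ≡ 1ℤ) (r∣s : + r Signed.∣ + s) where

  lattice⇒coordinates : ∀ {v} → Lattice r s p v → + r Signed.∣ det v q × + s Signed.∣ det p v
  lattice⇒coordinates ((r∣x , r∣y) , s∣) = ∣-detˡ q r∣x r∣y , s∣

  -- Both coefficients of the expansion of `v` in `p , q` are divisible by `r`, the second one
  -- because `r ∣ s`.
  coordinates⇒lattice : ∀ {v} → + r Signed.∣ det v q → + s Signed.∣ det p v → Lattice r s p v
  coordinates⇒lattice {v} r∣ s∣ =
    (subst (λ w → + r Signed.∣ proj₁ w) (expand p q v pq≡1) (∣-combination (proj₁ p) (proj₁ q) r∣ r∣′)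
    , subst (λ w → + r Signed.∣ proj₂ w) (expand p q v pq≡1) (∣-combination (proj₂ p) (proj₂ q) r∣ r∣′))
    , s∣
    where r∣′ = Signed.∣-trans r∣s s∣

  module _ (H : Subgroup ℤ² 0ℓ) (H≐ : Member H ≐ Lattice r s p) where

    private
      T = ℤ/ r ℤ ⊕ ℤ/ s ℤ
      module Q = AbelianGroup (ℤ² /ᴳ H)
      module T = AbelianGroup T

      f : ℤ × ℤ → ℤ × ℤ
      f v = det v q , det p v

      T-reflexive : ∀ {v w} → v ≡ w → v T.≈ w
      T-reflexive {v} refl = Setoid.refl T.setoid {v}

      f-cong : ∀ {v w} → v Q.≈ w → f v T.≈ f w
      f-cong {v} {w} v≈w with c , d ← lattice⇒coordinates {v ⊟ w} (proj₁ H≐ {v ⊟ w} v≈w) =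
        ∣⇒∣ᵤ (subst (+ r Signed.∣_) (det-⊟ˡ q v w) c) ,
        ∣⇒∣ᵤ (subst (+ s Signed.∣_) (det-⊟ʳ p v w) d)

      f-injective : ∀ {v w} → f v T.≈ f w → v Q.≈ w
      f-injective {v} {w} (c , d) = proj₂ H≐ {v ⊟ w} (coordinates⇒lattice {v ⊟ w}
        (subst (+ r Signed.∣_) (sym (det-⊟ˡ q v w)) (∣ᵤ⇒∣ {+ r} {det v q ℤ.- det w q} c))
        (subst (+ s Signed.∣_) (sym (det-⊟ʳ p v w)) (∣ᵤ⇒∣ {+ s} {det p v ℤ.- det p w} d)))

      f-section : ∀ α β → f (α · p ⊞ β · q) ≡ (α , β)
      f-section α β = cong₂ _,_
        (trans (det-⊞ˡ q (α · p) (β · q))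
          (trans (cong₂ ℤ._+_ (det-·ˡ α q p) (det-·ˡ β q q)) (combine₁ (det p q) (det q q) pq≡1 (det-self q))))
        (trans (det-⊞ʳ p (α · p) (β · q))
          (trans (cong₂ ℤ._+_ (det-·ʳ α p p) (det-·ʳ β p q)) (combine₂ (det p q) (det p p) pq≡1 (det-self p))))
        where
        combine₁ : ∀ u z → u ≡ 1ℤ → z ≡ 0ℤ → α ℤ.* u ℤ.+ β ℤ.* z ≡ α
        combine₁ _ _ refl refl = lemma α β
          where
          lemma : ∀ α β → α ℤ.* 1ℤ ℤ.+ β ℤ.* 0ℤ ≡ α
          lemma = solve-∀
        combine₂ : ∀ u z → u ≡ 1ℤ → z ≡ 0ℤ → α ℤ.* z ℤ.+ β ℤ.* u ≡ β
        combine₂ _ _ refl refl = lemma α β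
          where
          lemma : ∀ α β → α ℤ.* 0ℤ ℤ.+ β ℤ.* 1ℤ ≡ β
          lemma = solve-∀

    -- The coordinate map has kernel `H`, and `α p + β q` is a preimage of `(α , β)`. `H` is any
    -- subgroup with the members of the lattice, so that the result applies to a given subgroup and
    -- not only to `lattice r s p`.
    quotient-iso : (ℤ² /ᴳ H) ≅ T
    quotient-iso = f , record
      { isGroupMonomorphism = record
        { isGroupHomomorphism = record
          { isMonoidHomomorphism = record
            { isMagmaHomomorphism = record
              { isRelHomomorphism = record { cong = λ {v} {w} → f-cong {v} {w} }
              ; homo = λ v w → T-reflexive (cong₂ _,_ (det-⊞ˡ q v w) (det-⊞ʳ p v w))
              }
            ; ε-homo = T-reflexive (cong₂ _,_ (det-zeroˡ q) (det-zeroʳ p))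
            }
          ; ⁻¹-homo = λ v → T-reflexive (cong₂ _,_ (det-⊖ˡ q v) (det-⊖ʳ p v))
          }
        ; injective = λ {v} {w} → f-injective {v} {w}
        }
      ; surjective = λ (α , β) → (α · p ⊞ β · q) , λ {z} z≈ →
          subst (f z T.≈_) (f-section α β) (f-cong {z} {α · p ⊞ β · q} z≈)
      }

-- Residues and the order of `ℤ/r ⊕ ℤ/s`.

-- The distance of `i` and `j` is at most their maximum, hence below `m`, and 0 is the only multiple
-- of `m` there.
small-congruent⇒≡ : ∀ {m i j} → i ℕ.< m → j ℕ.< m → + m Signed.∣ + i ℤ.- + j → i ≡ j
small-congruent⇒≡ {m} {i} {j} i<m j<m m∣i-j =
  ℤP.+-injective (ℤP.i-j≡0⇒i≡j (+ i) (+ j) (ℤP.∣i∣≡0⇒i≡0 (multiple<⇒0 small (∣⇒∣ᵤ m∣i-j))))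
  where
  small : ℤ.∣ + i ℤ.- + j ∣ ℕ.< m
  small = ℕP.≤-<-trans
    (subst (λ z → ℤ.∣ z ∣ ℕ.≤ i ℕ.⊔ j) (sym (ℤP.m-n≡m⊖n i j)) (ℤP.∣m⊝n∣≤m⊔n i j))
    (ℕP.⊔-lub i<m j<m)

  multiple<⇒0 : ∀ {k} → k ℕ.< m → m ∣ k → k ≡ 0
  multiple<⇒0 {ℕ.zero}  _   _   = refl
  multiple<⇒0 {ℕ.suc _} k<m m∣k = ⊥-elim (ℕD.>⇒∤ k<m m∣k)

module _ (m : ℕ) .{{_ : NonZero m}} where

  residue : ℤ → Fin m
  residue x = fromℕ< (n%ℕd<d x m)

  residue-∣ : ∀ x → + m Signed.∣ x ℤ.- + toℕ (residue x)
  residue-∣ x = Signed.divides (x /ℕ m) (trans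
    (cong₂ ℤ._-_ (a≡a%ℕn+[a/ℕn]*n x m) (cong +_ (Fin.toℕ-fromℕ< (n%ℕd<d x m))))
    (lemma (+ (x %ℕ m)) ((x /ℕ m) ℤ.* + m)))
    where
    lemma : ∀ u v → (u ℤ.+ v) ℤ.- u ≡ v
    lemma = solve-∀

  residues : Inverse (AbelianGroup.setoid (ℤ/ m ℤ)) (Fin.≡-setoid m)
  residues = record
    { to        = residue
    ; from      = +_ ∘ toℕ
    ; to-cong   = λ {x} {y} m∣ → to-unique {y} {residue x}
        (subst (+ m Signed.∣_) (swap x (+ toℕ (residue x)) y)
          (Signed.∣m∣n⇒∣m-n (∣ᵤ⇒∣ {+ m} {x ℤ.- y} m∣) (residue-∣ x)))
    ; from-cong = λ { {i} refl → Setoid.refl (AbelianGroup.setoid (ℤ/ m ℤ)) {+ toℕ i} }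
    ; inverse   =
        (λ {i} {x} x≈i → sym (to-unique {x} {i} (subst (+ m Signed.∣_) (negate x (+ toℕ i))
          (Signed.∣m⇒∣-m (∣ᵤ⇒∣ {+ m} {x ℤ.- + toℕ i} x≈i)))))
      , (λ { {x} {_} refl → ∣⇒∣ᵤ {+ m} {+ toℕ (residue x) ℤ.- x} (subst (+ m Signed.∣_)
          (negate x (+ toℕ (residue x))) (Signed.∣m⇒∣-m (residue-∣ x))) })
    }
    where
    swap : ∀ x i y → (x ℤ.- y) ℤ.- (x ℤ.- i) ≡ i ℤ.- y
    swap = solve-∀
    negate : ∀ x i → ℤ.- (x ℤ.- i) ≡ i ℤ.- x
    negate = solve-∀
    telescope : ∀ i y j → (i ℤ.- y) ℤ.+ (y ℤ.- j) ≡ i ℤ.- j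
    telescope = solve-∀

    to-unique : ∀ {y} {i : Fin m} → + m Signed.∣ + toℕ i ℤ.- y → i ≡ residue y
    to-unique {y} {i} m∣ = Fin.toℕ-injective (small-congruent⇒≡ (Fin.toℕ<n i) (Fin.toℕ<n (residue y))
      (subst (+ m Signed.∣_) (telescope (+ toℕ i) y (+ toℕ (residue y)))
        (Signed.∣m∣n⇒∣m+n m∣ (residue-∣ y))))

ℤ/r⊕ℤ/s-cardinality : ∀ r s .{{_ : NonZero r}} .{{_ : NonZero s}} →
                      HasCardinality (AbelianGroup.setoid (ℤ/ r ℤ ⊕ ℤ/ s ℤ)) (r * s)
ℤ/r⊕ℤ/s-cardinality r s = Inverse⇒Bijection (Compose.inverse (residues r ×-inverse residues s) (record
  { to        = λ (i , j) → combine i j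
  ; from      = remQuot s
  ; to-cong   = λ (i≡ , j≡) → cong₂ combine i≡ j≡
  ; from-cong = λ { refl → refl , refl }
  ; inverse   = (λ { {k} (i≡ , j≡) → trans (cong₂ combine i≡ j≡) (Fin.combine-remQuot {r} s k) })
              , (λ { {i , j} refl → cong proj₁ (Fin.remQuot-combine i j) , cong proj₂ (Fin.remQuot-combine i j) })
  }))

≅⇒Bijection : ∀ {a b ℓ₁ ℓ₂} {A : AbelianGroup a ℓ₁} {B : AbelianGroup b ℓ₂} → A ≅ B →
              Bijection (AbelianGroup.setoid A) (AbelianGroup.setoid B)
≅⇒Bijection (f , iso) = record
  { to = f ; cong = I.⟦⟧-cong ; bijective = I.injective , I.surjective }
  where module I = GroupMorphisms.IsGroupIsomorphism iso

lattice-index : ∀ {r s} .{{_ : NonZero r}} .{{_ : NonZero s}} p q → det p q ≡ 1ℤ → + r Signed.∣ + s →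
                ∀ H → Member H ≐ Lattice r s p → HasCardinality (AbelianGroup.setoid (ℤ² /ᴳ H)) (r * s)
lattice-index {r} {s} p q pq≡1 r∣s H H≐ =
  Compose.bijection (≅⇒Bijection {A = ℤ² /ᴳ H} {ℤ/ r ℤ ⊕ ℤ/ s ℤ} (quotient-iso p q pq≡1 r∣s H H≐)) (ℤ/r⊕ℤ/s-cardinality r s)

-- Hermite forms of subgroups of finite index.

Hermite : ℤ → ℤ → ℤ → Pred (ℤ × ℤ) 0ℓ
Hermite c b a (x , y) = ∃₂ λ s t → x ≡ s ℤ.* c × y ≡ s ℤ.* b ℤ.+ t ℤ.* a

-- Here `m` is the expected index, not yet known to be one. A predicate takes the place of a
-- subgroup so that a bare span has a form as well.
HermiteForm : Pred (ℤ × ℤ) 0ℓ → ℕ → Set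
HermiteForm P m = ∃₂ λ c a → c * a ≡ m × ∃ λ (b : Fin a) → P ≐ Hermite (+ c) (+ toℕ b) (+ a)

LatticeForm : Pred (ℤ × ℤ) 0ℓ → ℕ → Set
LatticeForm P m = ∃₂ λ r d → r * (r * d) ≡ m × Σ Primitive λ (p , _) → P ≐ Lattice r (r * d) p

module _ (P : Pred ℤ 0ℓ) (P? : Decidable P) (P-closed : ∀ {x y} q → P x → P y → P (x ℤ.- q ℤ.* y)) where

  -- Division with remainder: the least positive element divides all the others, since a remainder
  -- stays in `P` and is smaller.
  generator : ∀ k .{{_ : NonZero k}} → P (+ k) → ∃ λ g → NonZero g × P (+ g) × (∀ {x} → P x → + g Signed.∣ x)
  generator (ℕ.suc k) Pk = descend k (<-wellFounded k) Pk
    where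
    descend : ∀ k → Acc ℕ._<_ k → P (+ ℕ.suc k) →
              ∃ λ g → NonZero g × P (+ g) × (∀ {x} → P x → + g Signed.∣ x)
    -- The values `suc j` with `j < k` are exactly the positive integers below `suc k`.
    descend k (acc smaller) Pk with Fin.any? (λ (j : Fin k) → P? (+ ℕ.suc (toℕ j)))
    ... | yes (j , Pj) = descend (toℕ j) (smaller (Fin.toℕ<n j)) Pj
    ... | no minimal   = ℕ.suc k , _ , Pk , λ {x} Px →
      Signed.divides (x /ℕ ℕ.suc k) (trans (a≡a%ℕn+[a/ℕn]*n x (ℕ.suc k))
        (trans (cong (λ i → + i ℤ.+ (x /ℕ ℕ.suc k) ℤ.* + ℕ.suc k) (vanishes (x %ℕ ℕ.suc k) (n%ℕd<d x (ℕ.suc k)) (remainder x Px)))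
               (ℤP.+-identityˡ _)))
      where
      remainder : ∀ x → P x → P (+ (x %ℕ ℕ.suc k))
      remainder x Px = subst P
        (trans (cong (λ z → z ℤ.- (x /ℕ ℕ.suc k) ℤ.* + ℕ.suc k) (a≡a%ℕn+[a/ℕn]*n x (ℕ.suc k)))
               (cancel (+ (x %ℕ ℕ.suc k)) ((x /ℕ ℕ.suc k) ℤ.* + ℕ.suc k)))
        (P-closed (x /ℕ ℕ.suc k) Px Pk)
        where
        cancel : ∀ u v → (u ℤ.+ v) ℤ.- v ≡ u
        cancel = solve-∀

      vanishes : ∀ i → i ℕ.< ℕ.suc k → P (+ i) → i ≡ 0
      vanishes ℕ.zero    _           _  = refl
      vanishes (ℕ.suc i) (ℕ.s≤s i<k) Pi = ⊥-elim (minimal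
        (fromℕ< i<k , subst (λ j → P (+ ℕ.suc j)) (sym (Fin.toℕ-fromℕ< i<k)) Pi))

module _ (M : Subgroup ℤ² 0ℓ) where
  open Subgroup M using (ε-closed; ∙-closed; ⁻¹-closed)

  ·ℕ-closed : ∀ k {v} → Member M v → Member M (+ k · v)
  ·ℕ-closed ℕ.zero    {x , y} _ = subst (Member M) (cong₂ _,_ (zero-times x) (zero-times y)) ε-closed
    where
    zero-times : ∀ x → 0ℤ ≡ 0ℤ ℤ.* x
    zero-times = solve-∀
  ·ℕ-closed (ℕ.suc k) {x , y} m = subst (Member M)
    (cong₂ _,_ (suc-times (+ k) x) (suc-times (+ k) y)) (∙-closed m (·ℕ-closed k m))
    where
    suc-times : ∀ k x → x ℤ.+ k ℤ.* x ≡ (1ℤ ℤ.+ k) ℤ.* x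
    suc-times = solve-∀

  ·-closed : ∀ k {v} → Member M v → Member M (k · v)
  ·-closed (+ k)        m = ·ℕ-closed k m
  ·-closed ℤ.-[1+ k ] {x , y} m = subst (Member M)
    (cong₂ _,_ (ℤP.neg-distribˡ-* (+ ℕ.suc k) x) (ℤP.neg-distribˡ-* (+ ℕ.suc k) y))
    (⁻¹-closed (·ℕ-closed (ℕ.suc k) m))

  ⊟-closed : ∀ {v w} → Member M v → Member M w → Member M (v ⊟ w)
  ⊟-closed m n = ∙-closed m (⁻¹-closed n)

  module _ {n} (index : HasCardinality (AbelianGroup.setoid (ℤ² /ᴳ M)) n) where
    private module B = Bijection index

    ∼⇒≡ : ∀ {v w} → Member M (v ⊟ w) → B.to v ≡ B.to w
    ∼⇒≡ {v} {w} = B.cong {v} {w}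

    ≡⇒∼ : ∀ {v w} → B.to v ≡ B.to w → Member M (v ⊟ w)
    ≡⇒∼ {v} {w} = B.injective {v} {w}

    ⊟-zero : ∀ v → v ⊟ (0ℤ , 0ℤ) ≡ v
    ⊟-zero (x , y) = cong₂ _,_ (ℤP.+-identityʳ x) (ℤP.+-identityʳ y)

    -- A vector lies in `M` exactly when it has the same class as 0, and classes are compared in
    -- `Fin n`.
    member? : Decidable (Member M)
    member? v = map′ (λ eq → subst (Member M) (⊟-zero v) (≡⇒∼ {v} {0ℤ , 0ℤ} eq))
                     (λ m → ∼⇒≡ {v} {0ℤ , 0ℤ} (subst (Member M) (sym (⊟-zero v)) m))
                     (B.to v Fin.≟ B.to (0ℤ , 0ℤ))

    torsion : ∀ v → ∃ λ k → NonZero k × Member M (+ k · v)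
    -- Two of the `n + 1` multiples by `0 , … , n` share one of the `n` classes; their difference is
    -- a positive multiple in `M`.
    torsion (x , y) with Fin.pigeonhole (ℕP.n<1+n n) (λ i → B.to (+ toℕ i · (x , y)))
    ... | i , j , i<j , eq = toℕ j ℕ.∸ toℕ i , ℕ.>-nonZero (ℕP.m<n⇒0<n∸m i<j) ,
      subst (Member M) (cong₂ _,_ (difference x) (difference y))
        (≡⇒∼ {+ toℕ j · (x , y)} {+ toℕ i · (x , y)} (sym eq))
      where
      difference : ∀ z → + toℕ j ℤ.* z ℤ.- + toℕ i ℤ.* z ≡ + (toℕ j ℕ.∸ toℕ i) ℤ.* z
      difference z = trans (factor (+ toℕ j) (+ toℕ i) z) (cong (ℤ._* z)
        (trans (ℤP.m-n≡m⊖n (toℕ j) (toℕ i)) (ℤP.⊖-≥ (ℕP.<⇒≤ i<j))))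
        where
        factor : ∀ u v z → u ℤ.* z ℤ.- v ℤ.* z ≡ (u ℤ.- v) ℤ.* z
        factor = solve-∀

    private
      Vertical Horizontal : Pred ℤ 0ℓ
      Vertical   y = Member M (0ℤ , y)
      Horizontal x = ∃ λ y → Member M (x , y)

      vertical-closed : ∀ {x y} q → Vertical x → Vertical y → Vertical (x ℤ.- q ℤ.* y)
      vertical-closed {x} {y} q m m′ = subst (λ z → Member M (z , x ℤ.- q ℤ.* y)) (lemma q)
        (⊟-closed m (·-closed q m′))
        where
        lemma : ∀ q → 0ℤ ℤ.- q ℤ.* 0ℤ ≡ 0ℤ
        lemma = solve-∀

      horizontal-closed : ∀ {x y} q → Horizontal x → Horizontal y → Horizontal (x ℤ.- q ℤ.* y)
      horizontal-closed q (_ , m) (_ , m′) = _ , ⊟-closed m (·-closed q m′)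

      vertical-generator : ∃ λ a → NonZero a × Vertical (+ a) × (∀ {y} → Vertical y → + a Signed.∣ y)
      vertical-generator with k , k≢0 , m ← torsion (0ℤ , 1ℤ) =
        generator Vertical (λ y → member? (0ℤ , y)) vertical-closed k {{k≢0}}
          (subst (Member M) (cong₂ _,_ (ℤP.*-zeroʳ (+ k)) (ℤP.*-identityʳ (+ k))) m)

    module _ (a : ℕ) .{{_ : NonZero a}} (0a : Member M (0ℤ , + a)) where

      reduce : ∀ {x y} → Member M (x , y) → Member M (x , + toℕ (residue a y))
      reduce {x} {y} m with Signed.divides q eq ← residue-∣ a y = subst (Member M)
        (cong₂ _,_ (first x q) (trans (cong (λ z → y ℤ.- z) (sym eq)) (second y (+ toℕ (residue a y)))))
        (⊟-closed m (·-closed q 0a))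
        where
        first : ∀ x q → x ℤ.- q ℤ.* 0ℤ ≡ x
        first = solve-∀
        second : ∀ y i → y ℤ.- (y ℤ.- i) ≡ i
        second = solve-∀

      -- Subtracting multiples of `(0 , a)` bounds the second coordinate, so the search over all
      -- integers becomes a finite one.
      horizontal? : Decidable Horizontal
      horizontal? x = map′ (λ (i , m) → + toℕ i , m) (λ (y , m) → residue a y , reduce m)
        (Fin.any? (λ i → member? (x , + toℕ i)))

    -- `a` generates the intersection of `M` with the vertical axis and `c` its projection to the
    -- first coordinate. A lift of `c` is determined up to multiples of `a`, which leaves the
    -- residue `b`.
    hermite-form : ∃ λ m → NonZero m × HermiteForm (Member M) m
    hermite-form
      with a , a≢0 , 0a , a∣ ← vertical-generator
      with k , k≢0 , m ← torsion (1ℤ , 0ℤ)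
      with c , c≢0 , (y₀ , cy₀) , c∣ ← generator Horizontal (horizontal? a {{a≢0}} 0a) horizontal-closed k {{k≢0}}
             (+ k ℤ.* 0ℤ , subst (λ z → Member M (z , + k ℤ.* 0ℤ)) (ℤP.*-identityʳ (+ k)) m) =
      c * a , ℕP.m*n≢0 c a {{c≢0}} {{a≢0}} , c , a , refl , b , forth , back
      where
      b = residue a {{a≢0}} y₀

      cb : Member M (+ c , + toℕ b)
      cb = reduce a {{a≢0}} 0a cy₀

      forth : ∀ {v} → Member M v → Hermite (+ c) (+ toℕ b) (+ a) v
      forth {x , y} m
        with Signed.divides s x≡sc ← c∣ (y , m)
        with Signed.divides t eq ← a∣ {y ℤ.- s ℤ.* + toℕ b} (subst (λ z → Member M (z , y ℤ.- s ℤ.* + toℕ b))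
               (trans (cong (ℤ._- s ℤ.* + c) x≡sc) (ℤP.+-inverseʳ (s ℤ.* + c)))
               (⊟-closed m (·-closed s cb))) =
        s , t , x≡sc , trans (restore y (s ℤ.* + toℕ b)) (cong (λ z → s ℤ.* + toℕ b ℤ.+ z) eq)
        where
        restore : ∀ y z → y ≡ z ℤ.+ (y ℤ.- z)
        restore = solve-∀

      back : ∀ {v} → Hermite (+ c) (+ toℕ b) (+ a) v → Member M v
      back (s , t , refl , refl) = subst (λ z → Member M (z , s ℤ.* + toℕ b ℤ.+ t ℤ.* + a))
        (lemma s t (+ c)) (∙-closed (·-closed s cb) (·-closed t 0a))
        where
        lemma : ∀ s t c → s ℤ.* c ℤ.+ t ℤ.* 0ℤ ≡ s ℤ.* c
        lemma = solve-∀

-- From Hermite forms to lattices.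

-- t is the largest divisor of c prime to b.
coprime-part : ∀ c b .{{_ : NonZero c}} → ∃ λ t → Coprime t b ×
               (∀ {e} → e ∣ c → Coprime e t → Coprime e b → e ≡ 1)
coprime-part c b = go c (<-wellFounded c)
  where
  go : ∀ c .{{_ : NonZero c}} → Acc ℕ._<_ c → ∃ λ t → Coprime t b ×
       (∀ {e} → e ∣ c → Coprime e t → Coprime e b → e ≡ 1)
  go c (acc smaller) with ℕG.gcd c b in gcd≡ | ℕG.gcd[m,n]∣m c b | ℕG.gcd[m,n]∣n c b
  ... | 0 | 0∣c | _ = ⊥-elim (ℕ.≢-nonZero⁻¹ c (ℕD.0∣⇒≡0 0∣c))
  ... | 1 | _ | _ = c , gcd≡1⇒coprime gcd≡ , λ e∣c e⊥c _ → e⊥c (ℕD.∣-refl , e∣c)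
  ... | g@(ℕ.suc (ℕ.suc _)) | g∣c@(ℕD.divides c₁ c≡) | g∣b =
    -- A factor shared with `b` is cast out of `c`: an `e` coprime to `b` is coprime to `g`, so
    -- `e ∣ c₁ g` already gives `e ∣ c₁`.
    let t , t⊥b , kill = go c₁ {{c₁≢0}} (smaller c₁<c)
    in t , t⊥b , λ {e} e∣c e⊥t e⊥b → kill
         (Coprimality.coprime-divisor {n = g} (λ (d∣e , d∣g) → e⊥b (d∣e , ℕD.∣-trans d∣g g∣b))
           (subst (e ∣_) (trans c≡ (ℕP.*-comm c₁ g)) e∣c)) e⊥t e⊥b
    where
    c₁≢0 : NonZero c₁
    c₁≢0 = ℕ.≢-nonZero λ { refl → ℕ.≢-nonZero⁻¹ c c≡ }
    c₁<c : c₁ ℕ.< c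
    c₁<c = subst (c₁ ℕ.<_) (sym c≡) (ℕP.m<m*n c₁ g {{c₁≢0}} (ℕ.s≤s (ℕ.s≤s ℕ.z≤n)))

-- Let `e` divide `c` and `b + ta`. A common factor of `e` and `t` divides `b`, hence is 1. A common
-- factor of `e` and `b` divides `ta`, is coprime to `t`, so divides `a` and is 1 by hypothesis.
-- Thus `e` is a divisor of `c` coprime to both `t` and `b`.
coprime-translate : ∀ c b a .{{_ : NonZero c}} → (∀ {e} → e ∣ c → e ∣ b → e ∣ a → e ≡ 1) →
                    ∃ λ t → Coprime c (b ℕ.+ t * a)
coprime-translate c b a coprime₃ with t , t⊥b , kill ← coprime-part c b = t , λ {e} (e∣c , e∣b+ta) →
  let e⊥t : Coprime e t
      e⊥t = λ {f} (f∣e , f∣t) → t⊥b (f∣t , ℕD.∣m+n∣m⇒∣n (subst (f ∣_) (ℕP.+-comm b (t * a)) (ℕD.∣-trans f∣e e∣b+ta)) (ℕD.∣m⇒∣m*n a f∣t))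
  in kill e∣c e⊥t λ {f} (f∣e , f∣b) → coprime₃ (ℕD.∣-trans f∣e e∣c) f∣b
       (Coprimality.coprime-divisor {n = t} (λ (d∣f , d∣t) → e⊥t (ℕD.∣-trans d∣f f∣e , d∣t))
         (ℕD.∣m+n∣m⇒∣n (ℕD.∣-trans f∣e e∣b+ta) f∣b))

-- The left-hand side contains r p for every p = (c , b + ta); the choice of t serves to make p primitive.
hermite≐lattice : ∀ r c b a t q s → + s ≡ + r ℤ.* (c ℤ.* a) →
  det (c , b ℤ.+ t ℤ.* a) q ≡ 1ℤ →
  Hermite (c ℤ.* + r) (b ℤ.* + r) (a ℤ.* + r) ≐ Lattice r s (c , b ℤ.+ t ℤ.* a)
hermite≐lattice r c b a t q@(u , w) s s≡ pq≡1 = forth , back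
  where
  p = c , b ℤ.+ t ℤ.* a

  r∣s : + r Signed.∣ + s
  r∣s = Signed.divides (c ℤ.* a) (trans s≡ (ℤP.*-comm (+ r) _))

  forth : ∀ {v} → Hermite (c ℤ.* + r) (b ℤ.* + r) (a ℤ.* + r) v → Lattice r s p v
  forth (i , j , refl , refl) =
    (Signed.divides (i ℤ.* c) (sym (ℤP.*-assoc i c (+ r)))
    , Signed.divides (i ℤ.* b ℤ.+ j ℤ.* a) (second i j b a (+ r)))
    -- Since `r (c , b) = r p - t (0 , ra)`, the determinant with `p` is `j - it` times
    -- `det p (0 , ra) = rca`.
    , Signed.divides (j ℤ.- i ℤ.* t)
        (trans (third i j c b a t (+ r)) (cong ((j ℤ.- i ℤ.* t) ℤ.*_) (sym s≡)))
    where
    second : ∀ i j b a r → i ℤ.* (b ℤ.* r) ℤ.+ j ℤ.* (a ℤ.* r) ≡ (i ℤ.* b ℤ.+ j ℤ.* a) ℤ.* r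
    second = solve-∀
    third : ∀ i j c b a t r → c ℤ.* (i ℤ.* (b ℤ.* r) ℤ.+ j ℤ.* (a ℤ.* r)) ℤ.- (b ℤ.+ t ℤ.* a) ℤ.* (i ℤ.* (c ℤ.* r))
            ≡ (j ℤ.- i ℤ.* t) ℤ.* (r ℤ.* (c ℤ.* a))
    third = solve-∀

  back : ∀ {v} → Lattice r s p v → Hermite (c ℤ.* + r) (b ℤ.* + r) (a ℤ.* + r) v
  back {v} m
    with Signed.divides α eq₁ , Signed.divides β eq₂ ← lattice⇒coordinates p q pq≡1 r∣s {v} m =
    -- Here `r p` is `(rc , rb) + t (0 , ra)`, while `rca q` is `au (rc , rb) + (cw - bu) (0 , ra)`.
    α ℤ.+ β ℤ.* a ℤ.* u , α ℤ.* t ℤ.+ β ℤ.* (c ℤ.* w ℤ.- b ℤ.* u) ,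
    trans (cong proj₁ v≡) (first α β c a u (+ r)) ,
    trans (cong proj₂ v≡) (second α β c b a t u w (+ r))
    where
    v≡ : v ≡ α ℤ.* + r · p ⊞ β ℤ.* (+ r ℤ.* (c ℤ.* a)) · q
    v≡ = trans (sym (expand p q v pq≡1))
      (cong₂ (λ x y → x · p ⊞ y · q) eq₁ (trans eq₂ (cong (β ℤ.*_) s≡)))
    first : ∀ α β c a u r → α ℤ.* r ℤ.* c ℤ.+ β ℤ.* (r ℤ.* (c ℤ.* a)) ℤ.* u
            ≡ (α ℤ.+ β ℤ.* a ℤ.* u) ℤ.* (c ℤ.* r)
    first = solve-∀
    second : ∀ α β c b a t u w r →
      α ℤ.* r ℤ.* (b ℤ.+ t ℤ.* a) ℤ.+ β ℤ.* (r ℤ.* (c ℤ.* a)) ℤ.* w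
      ≡ (α ℤ.+ β ℤ.* a ℤ.* u) ℤ.* (b ℤ.* r) ℤ.+ (α ℤ.* t ℤ.+ β ℤ.* (c ℤ.* w ℤ.- b ℤ.* u)) ℤ.* (a ℤ.* r)
    second = solve-∀

hermite⇒lattice : ∀ c b a .{{_ : NonZero c}} .{{_ : NonZero a}} →
  LatticeForm (Hermite (+ c) (+ b) (+ a)) (c * a)
hermite⇒lattice c b a
  with ℕG.gcd c (ℕG.gcd b a) in g≡ | ℕG.gcd[m,n]∣m c (ℕG.gcd b a) | ℕD.∣-trans (ℕG.gcd[m,n]∣n c (ℕG.gcd b a)) (ℕG.gcd[m,n]∣m b a)
     | ℕD.∣-trans (ℕG.gcd[m,n]∣n c (ℕG.gcd b a)) (ℕG.gcd[m,n]∣n b a)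
... | r | ℕD.divides c′ refl | ℕD.divides b′ refl | ℕD.divides a′ refl =
  r , c′ * a′ , ℕ-regroup c′ a′ r , (p , cong +_ (Coprimality.coprime⇒gcd≡1 c′⊥b′+ta′)) ,
  subst (λ H → H ≐ Lattice r (r * (c′ * a′)) p)
    (hermite-cong (sym (ℤP.pos-* c′ r)) (sym (ℤP.pos-* b′ r)) (sym (ℤP.pos-* a′ r)))
    (subst (λ z → Hermite (+ c′ ℤ.* + r) (+ b′ ℤ.* + r) (+ a′ ℤ.* + r) ≐ Lattice r (r * (c′ * a′)) (+ c′ , z))
      (sym cast)
      (hermite≐lattice r (+ c′) (+ b′) (+ a′) (+ t) (proj₁ q) (r * (c′ * a′))
        (trans (ℤP.pos-* r (c′ * a′)) (cong (+ r ℤ.*_) (ℤP.pos-* c′ a′)))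
        (subst (λ z → det (+ c′ , z) (proj₁ q) ≡ 1ℤ) cast (proj₂ q))))
  where
  instance
    r≢0 : NonZero r
    r≢0 = ℕP.m*n≢0⇒n≢0 c′
    c′≢0 : NonZero c′
    c′≢0 = ℕP.m*n≢0⇒m≢0 c′
  hermite-cong : ∀ {c c′ b b′ a a′} → c ≡ c′ → b ≡ b′ → a ≡ a′ → Hermite c b a ≡ Hermite c′ b′ a′
  hermite-cong refl refl refl = refl
  ℕ-regroup : ∀ c a r → r * (r * (c * a)) ≡ c * r * (a * r)
  ℕ-regroup = ℕSolver.solve-∀
  translate : ∃ λ t → Coprime c′ (b′ ℕ.+ t * a′)
  -- If `e` divides the three reduced entries, then `e * r` divides the original ones and so their
  -- gcd `r`.
  translate = coprime-translate c′ b′ a′ λ {e} e∣c′ e∣b′ e∣a′ →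
    ℕD.∣1⇒≡1 (ℕD.*-cancelʳ-∣ r (subst (e * r ∣_) (trans g≡ (sym (ℕP.*-identityˡ r)))
      (ℕG.gcd-greatest (ℕD.*-monoˡ-∣ r e∣c′) (ℕG.gcd-greatest (ℕD.*-monoˡ-∣ r e∣b′) (ℕD.*-monoˡ-∣ r e∣a′)))))
  t = proj₁ translate
  c′⊥b′+ta′ = proj₂ translate
  p = + c′ , + (b′ ℕ.+ t * a′)
  cast : + (b′ ℕ.+ t * a′) ≡ + b′ ℤ.+ + t ℤ.* + a′
  cast = cong (λ z → + b′ ℤ.+ z) (ℤP.pos-* t a′)
  q : ∃ λ q → det p q ≡ 1ℤ
  q = gcd≡1⇒det≡1 (proj₁ p) (proj₂ p) (cong +_ (Coprimality.coprime⇒gcd≡1 c′⊥b′+ta′))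

-- Comparison of lattices.

nonZero-≡ : ∀ {m n} → m ≡ n → .{{NonZero n}} → NonZero m
nonZero-≡ {n = n} refl = ℕ.≢-nonZero (ℕ.≢-nonZero⁻¹ n)

m*m≡n*n⇒m≡n : ∀ {m n} → m * m ≡ n * n → m ≡ n
m*m≡n*n⇒m≡n {m} {n} eq with ℕP.<-cmp m n
... | tri< m<n _ _ = ⊥-elim (ℕP.<⇒≢ (ℕP.*-mono-< m<n m<n) eq)
... | tri≈ _ m≡n _ = m≡n
... | tri> _ _ n<m = ⊥-elim (ℕP.<⇒≢ (ℕP.*-mono-< n<m n<m) (sym eq))

cardinality-unique : ∀ {a ℓ} {S : Setoid a ℓ} {m n} → HasCardinality S m → HasCardinality S n → m ≡ n
cardinality-unique {S = S} B C = ℕP.≤-antisym (≤ B C) (≤ C B)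
  where
  ≤ : ∀ {m n} → HasCardinality S m → HasCardinality S n → m ℕ.≤ n
  ≤ B C = Fin.injective⇒≤ {f = C.to ∘ from} (λ {i} {j} eq →
    trans (sym (to∘from i)) (trans (B.cong (C.injective eq)) (to∘from j)))
    where
    module B = Bijection B
    module C = Bijection C
    from = λ i → proj₁ (B.surjective i)
    to∘from : ∀ i → B.to (from i) ≡ i
    to∘from i = proj₂ (B.surjective i) (Setoid.refl S)

r∣r*s : ∀ r s → + r Signed.∣ + (r * s)
r∣r*s r s = ∣ᵤ⇒∣ {+ r} {+ (r * s)} (ℕD.m∣m*n s)

rp∈lattice : ∀ r d p → Lattice r (r * d) p (+ r · p)
rp∈lattice r d p =
  (Signed.divides (proj₁ p) (ℤP.*-comm (+ r) _) , Signed.divides (proj₂ p) (ℤP.*-comm (+ r) _)) ,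
  Signed.divides 0ℤ (trans (det-·ʳ (+ r) p p) (trans (cong (+ r ℤ.*_) (det-self p)) (ℤP.*-zeroʳ (+ r))))

∣-primitive : ∀ {r k} p q → det p q ≡ 1ℤ → + k Signed.∣ proj₁ (+ r · p) → + k Signed.∣ proj₂ (+ r · p) → k ∣ r
∣-primitive {r} {k} p q pq≡1 k∣₁ k∣₂ = ∣⇒∣ᵤ {+ k} {+ r} (subst (+ k Signed.∣_)
  (trans (det-·ˡ (+ r) q p) (trans (cong (+ r ℤ.*_) pq≡1) (ℤP.*-identityʳ (+ r))))
  (∣-detˡ q k∣₁ k∣₂))

-- Tested on `r p`: as `p` is primitive, only divisors of `r` divide both of its coordinates.
lattice-⊆⇒∣ : ∀ {r d} p q {r′ s′} p′ → det p q ≡ 1ℤ → Lattice r (r * d) p ⊆ Lattice r′ s′ p′ → r′ ∣ r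
lattice-⊆⇒∣ {r} {d} p q p′ pq≡1 L⊆ with (r′∣₁ , r′∣₂) , _ ← L⊆ {+ r · p} (rp∈lattice r d p) =
  ∣-primitive {r} p q pq≡1 r′∣₁ r′∣₂

-- Tested on `r p′`, whose determinant with `p` is `r` times `det p p′`.
lattice-⊆⇒∣det : ∀ {r d} .{{_ : NonZero r}} p p′ → Lattice r (r * d) p′ ⊆ Lattice r (r * d) p → + d Signed.∣ det p p′
lattice-⊆⇒∣det {r} {d} p p′ L⊆ = Signed.*-cancelˡ-∣ (+ r)
  (subst₂ Signed._∣_ (ℤP.pos-* r d) (det-·ʳ (+ r) p p′) (proj₂ (L⊆ {+ r · p′} (rp∈lattice r d p′))))

-- Expand `v` in the basis `p , q`. In `det p′ v` the `p` term gets a factor `r` from its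
-- coefficient and a factor `d` from `det p′ p`; the coefficient of `q` is already a multiple of
-- `rd`.
∣det⇒lattice-⊆ : ∀ {r d} p q p′ → det p q ≡ 1ℤ → + d Signed.∣ det p p′ → Lattice r (r * d) p ⊆ Lattice r (r * d) p′
∣det⇒lattice-⊆ {r} {d} p q p′ pq≡1 (Signed.divides k eq) {v} m
  with Signed.divides α αeq , rd∣β ← lattice⇒coordinates p q pq≡1 (r∣r*s r d) {v} m =
  proj₁ m , subst (+ (r * d) Signed.∣_) (trans (sym expanded) (cong (det p′) (expand p q v pq≡1)))
    (Signed.∣m∣n⇒∣m+n (Signed.divides (ℤ.- (α ℤ.* k)) multiple) (Signed.∣m⇒∣m*n (det p′ q) rd∣β))
  where
  expanded : det p′ (det v q · p ⊞ det p v · q) ≡ det v q ℤ.* det p′ p ℤ.+ det p v ℤ.* det p′ q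
  expanded = trans (det-⊞ʳ p′ (det v q · p) (det p v · q))
                   (cong₂ ℤ._+_ (det-·ʳ (det v q) p′ p) (det-·ʳ (det p v) p′ q))

  multiple : det v q ℤ.* det p′ p ≡ ℤ.- (α ℤ.* k) ℤ.* + (r * d)
  multiple = trans (cong₂ ℤ._*_ αeq (trans (det-swap p′ p) (cong ℤ.-_ eq)))
    (trans (lemma α k (+ r) (+ d)) (cong (ℤ.- (α ℤ.* k) ℤ.*_) (sym (ℤP.pos-* r d))))
    where
    lemma : ∀ α k r d → α ℤ.* r ℤ.* ℤ.- (k ℤ.* d) ≡ ℤ.- (α ℤ.* k) ℤ.* (r ℤ.* d)
    lemma = solve-∀

-- The exponent as an invariant of the quotient.

module _ {a b ℓ₁ ℓ₂} {A : AbelianGroup a ℓ₁} {B : AbelianGroup b ℓ₂} where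
  private
    module A = AbelianGroup A
    module B = AbelianGroup B
    module AM = Mult A.monoid
    module BM = Mult B.monoid

  module _ (φ : A ≅ B) where
    private
      f = proj₁ φ
      module F = GroupMorphisms.IsGroupIsomorphism (proj₂ φ)
    open ≈-Reasoning B.setoid

    ×-homo : ∀ k x → f (k AM.× x) B.≈ k BM.× f x
    ×-homo ℕ.zero    x = F.ε-homo
    ×-homo (ℕ.suc k) x = B.trans (F.∙-homo x (k AM.× x)) (B.∙-congˡ (×-homo k x))

    annihilates-≅ : ∀ k → (∀ x → k AM.× x A.≈ A.ε) → ∀ y → k BM.× y B.≈ B.ε
    annihilates-≅ k kA≈ε y with x , fx≈y ← F.surjective y = begin
      k BM.× y        ≈⟨ BM.×-congʳ k (fx≈y A.refl) ⟨
      k BM.× f x      ≈⟨ ×-homo k x ⟨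
      f (k AM.× x)    ≈⟨ F.⟦⟧-cong (kA≈ε x) ⟩
      f A.ε           ≈⟨ F.ε-homo ⟩
      B.ε             ∎

    annihilates-≅⁻ : ∀ k → (∀ y → k BM.× y B.≈ B.ε) → ∀ x → k AM.× x A.≈ A.ε
    annihilates-≅⁻ k kB≈ε x = F.injective (begin
      f (k AM.× x)    ≈⟨ ×-homo k x ⟩
      k BM.× f x      ≈⟨ kB≈ε (f x) ⟩
      B.ε             ≈⟨ F.ε-homo ⟨
      f A.ε           ∎)

-- Repeated addition depends only on carrier and operations. With the relation left free, one
-- identity serves the quotients of `ℤ²` and the sums `ℤ/r ⊕ ℤ/s`.
×≡· : ∀ {ℓ} (_≈_ : Rel (ℤ × ℤ) ℓ) k v →
      RawMonoidDefinitions._×_ (record { _≈_ = _≈_; _∙_ = _⊞_; ε = 0ℤ , 0ℤ }) k v ≡ + k · v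
×≡· _≈_ ℕ.zero    (x , y) = cong₂ _,_ (sym (ℤP.*-zeroˡ x)) (sym (ℤP.*-zeroˡ y))
×≡· _≈_ (ℕ.suc k) (x , y) = trans (cong ((x , y) ⊞_) (×≡· _≈_ k (x , y)))
  (cong₂ _,_ (sym (ℤP.suc-* (+ k) x)) (sym (ℤP.suc-* (+ k) y)))

module _ (r s : ℕ) where
  private
    module T = AbelianGroup (ℤ/ r ℤ ⊕ ℤ/ s ℤ)
    module TM = Mult T.monoid

  annihilates⇒∣ : ∀ {k} → (∀ v → k TM.× v T.≈ T.ε) → s ∣ k
  annihilates⇒∣ {k} kT≈ε = subst (λ z → s ∣ ℤ.∣ z ∣)
    (trans (cong (λ v → proj₂ v ℤ.- 0ℤ) (×≡· T._≈_ k (0ℤ , 1ℤ)))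
      (trans (ℤP.+-identityʳ _) (ℤP.*-identityʳ (+ k)))) (proj₂ (kT≈ε (0ℤ , 1ℤ)))

  ∣⇒annihilates : ∀ {k} → r ∣ s → s ∣ k → ∀ v → k TM.× v T.≈ T.ε
  ∣⇒annihilates {k} r∣s s∣k v@(x , y) = subst (T._≈ T.ε) (sym (×≡· T._≈_ k v))
    (multiple x (ℕD.∣-trans r∣s s∣k) , multiple y s∣k)
    where
    multiple : ∀ {m} x → m ∣ k → + m ℤD.∣ + k ℤ.* x ℤ.- 0ℤ
    multiple {m} x m∣k = ∣⇒∣ᵤ (subst (+ m Signed.∣_) (sym (ℤP.+-identityʳ (+ k ℤ.* x)))
      (Signed.∣m⇒∣m*n x (∣ᵤ⇒∣ {+ m} {+ k} m∣k)))

-- If r ∣ s then s is the exponent of ℤ/r ⊕ ℤ/s.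
exponent-∣ : ∀ {a ℓ} {A : AbelianGroup a ℓ} {r s r′ s′} → r′ ∣ s′ →
             A ≅ ℤ/ r ℤ ⊕ ℤ/ s ℤ → A ≅ ℤ/ r′ ℤ ⊕ ℤ/ s′ ℤ → s ∣ s′
exponent-∣ {A = A} {r} {s} {r′} {s′} r′∣s′ φ ψ = annihilates⇒∣ r s
  (annihilates-≅ {A = A} {ℤ/ r ℤ ⊕ ℤ/ s ℤ} φ s′
    (annihilates-≅⁻ {A = A} {ℤ/ r′ ℤ ⊕ ℤ/ s′ ℤ} ψ s′ (∣⇒annihilates r′ s′ r′∣s′ ℕD.∣-refl)))

exponent-unique : ∀ {a ℓ} {A : AbelianGroup a ℓ} {r s r′ s′} → r ∣ s → r′ ∣ s′ →
                  A ≅ ℤ/ r ℤ ⊕ ℤ/ s ℤ → A ≅ ℤ/ r′ ℤ ⊕ ℤ/ s′ ℤ → s ≡ s′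
exponent-unique {A = A} {r} {s} {r′} {s′} r∣s r′∣s′ φ ψ = ℕD.∣-antisym
  (exponent-∣ {A = A} {r} {s} {r′} {s′} r′∣s′ φ ψ) (exponent-∣ {A = A} {r′} {s′} {r} {s} r∣s ψ φ)

-- Cyclic quotients.

module _ (H : Subgroup ℤ² 0ℓ) where

  private
    Q = ℤ² /ᴳ H
    module Q = AbelianGroup Q

  ×ℤ≡· : ∀ k v → _×ℤ_ Q k v ≡ k · v
  ×ℤ≡· (+ k)        v       = ×≡· Q._≈_ k v
  ×ℤ≡· ℤ.-[1+ k ] v@(x , y) = trans (cong ⊖_ (×≡· Q._≈_ (ℕ.suc k) v))
    (cong₂ _,_ (ℤP.neg-distribˡ-* (+ ℕ.suc k) x) (ℤP.neg-distribˡ-* (+ ℕ.suc k) y))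

  -- The complement `q` generates, because `v - det(p , v) q` is a multiple of `p`.
  primitive⇒cyclic : ∀ p q → det p q ≡ 1ℤ → Member H p → Cyclic Q
  primitive⇒cyclic p q pq≡1 p∈H = q , λ v → det p v ,
    subst (λ w → Member H (v ⊟ w)) (sym (×ℤ≡· (det p v) q))
      (subst (Member H) (remainder v) (·-closed H (det v q) p∈H))
    where
    remainder : ∀ v → det v q · p ≡ v ⊟ det p v · q
    remainder v = trans (cancel (det v q · p) (det p v · q)) (cong (_⊟ det p v · q) (expand p q v pq≡1))
      where
      cancel : ∀ u w → u ≡ (u ⊞ w) ⊟ w
      cancel (x , y) (x′ , y′) = cong₂ _,_ (lemma x x′) (lemma y y′)
        where
        lemma : ∀ x x′ → x ≡ (x ℤ.+ x′) ℤ.- x′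
        lemma = solve-∀

  -- (1 , 0) and (0 , 1) are multiples of one vector modulo r, so their determinant vanishes modulo r.
  cyclic⇒r≡1 : ∀ {r s p} → Member H ⊆ Lattice r s p → Cyclic Q → r ≡ 1
  cyclic⇒r≡1 {r} H⊆L (g@(g₁ , g₂) , generates)
    with k , e₁∼kg ← generates (1ℤ , 0ℤ)
       | l , e₂∼lg ← generates (0ℤ , 1ℤ)
    with (A , B) , _ ← H⊆L (subst (λ w → Member H ((1ℤ , 0ℤ) ⊟ w)) (×ℤ≡· k g) e₁∼kg)
       | (C , D) , _ ← H⊆L (subst (λ w → Member H ((0ℤ , 1ℤ) ⊟ w)) (×ℤ≡· l g) e₂∼lg) =
    ℕD.∣1⇒≡1 (∣⇒∣ᵤ {+ r} {1ℤ} (subst (+ r Signed.∣_) (sym (det≡1 k l g₁ g₂))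
      (Signed.∣m∣n⇒∣m+n (Signed.∣m⇒∣m*n (l ℤ.* g₂) A)
        (Signed.∣m∣n⇒∣m+n D (Signed.∣m⇒∣m*n (0ℤ ℤ.- l ℤ.* g₁) B)))))
    where
    det≡1 : ∀ k l g₁ g₂ → 1ℤ ≡ (1ℤ ℤ.- k ℤ.* g₁) ℤ.* (l ℤ.* g₂) ℤ.+
              ((1ℤ ℤ.- l ℤ.* g₂) ℤ.+ (0ℤ ℤ.- k ℤ.* g₂) ℤ.* (0ℤ ℤ.- l ℤ.* g₁))
    det≡1 = solve-∀

-- Lattices attached to points of the disjoint union.

open ⨆PF¹-Carrier using (divisor; isSquare; point)

module _ {n : ℕ} where

  scale : ⨆PF¹-Carrier n → ℕ
  scale x = root (isSquare x)

  vector : ⨆PF¹-Carrier n → ℤ × ℤ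
  vector x = proj₁ (point x)

  complement : ∀ x → ∃ λ q → det (vector x) q ≡ 1ℤ
  complement x = gcd≡1⇒det≡1 (proj₁ (vector x)) (proj₂ (vector x)) (proj₂ (point x))

  latticeAt : ⨆PF¹-Carrier n → Pred (ℤ × ℤ) 0ℓ
  latticeAt x = Lattice (scale x) (scale x * component x) (vector x)

  index≡ : ∀ x → scale x * (scale x * component x) ≡ n
  index≡ record { component = d ; divisor = ℕD.divides _ refl ; isSquare = square r refl } =
    sym (ℕP.*-assoc r r d)

  module _ .{{_ : NonZero n}} where

    scale≢0 : ∀ x → NonZero (scale x)
    scale≢0 x = ℕP.m*n≢0⇒m≢0 (scale x) {{nonZero-≡ (index≡ x)}}

    scale*component≢0 : ∀ x → NonZero (scale x * component x)
    scale*component≢0 x = ℕP.m*n≢0⇒n≢0 (scale x) {{nonZero-≡ (index≡ x)}}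

    component≢0 : ∀ x → NonZero (component x)
    component≢0 x = ℕP.m*n≢0⇒n≢0 (scale x) {{scale*component≢0 x}}

    -- In `n = r²d` with `n` positive, `d` determines `r`. Equality of points compares components
    -- only, so the stored roots have to be matched separately.
    component≡⇒scale≡ : ∀ x y → component x ≡ component y → scale x ≡ scale y
    component≡⇒scale≡ x y refl = m*m≡n*n⇒m≡n (ℕP.*-cancelʳ-≡ _ _ (component y) {{component≢0 y}} (begin
      scale x * scale x * component y     ≡⟨ ℕP.*-assoc (scale x) (scale x) (component y) ⟩
      scale x * (scale x * component y)   ≡⟨ trans (index≡ x) (sym (index≡ y)) ⟩
      scale y * (scale y * component y)   ≡⟨ ℕP.*-assoc (scale y) (scale y) (component y) ⟨
      scale y * scale y * component y     ∎))
      where open ≡-Reasoning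

    scale≡⇒component≡ : ∀ x y → scale x ≡ scale y → component x ≡ component y
    scale≡⇒component≡ x y eq = ℕP.*-cancelˡ-≡ _ _ (scale x) {{scale≢0 x}}
      (ℕP.*-cancelˡ-≡ _ _ (scale x) {{scale≢0 x}} (begin
        scale x * (scale x * component x)   ≡⟨ trans (index≡ x) (sym (index≡ y)) ⟩
        scale y * (scale y * component y)   ≡⟨ cong (λ r → r * (r * component y)) eq ⟨
        scale x * (scale x * component y)   ∎))
      where open ≡-Reasoning

    private module ⨆ = Setoid (⨆PF¹ n)

    latticeAt-injective : ∀ x y → latticeAt x ≐ latticeAt y → x ⨆.≈ y
    latticeAt-injective x y (⊆ , ⊇) = d≡ , ∣⇒∣ᵤ {+ component x} (lattice-⊆⇒∣det {{scale≢0 x}} (vector x) (vector y)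
        (λ {v} m → ⊇ {v} (subst₂ (λ r d → Lattice r (r * d) (vector y) v) r≡ d≡ m)))
      where
      r≡ : scale x ≡ scale y
      r≡ = ℕD.∣-antisym
        (lattice-⊆⇒∣ (vector y) (proj₁ (complement y)) (vector x) (proj₂ (complement y)) (λ {v} → ⊇ {v}))
        (lattice-⊆⇒∣ (vector x) (proj₁ (complement x)) (vector y) (proj₂ (complement x)) (λ {v} → ⊆ {v}))
      d≡ : component x ≡ component y
      d≡ = scale≡⇒component≡ x y r≡

    latticeAt-⊆ : ∀ x y → x ⨆.≈ y → latticeAt x ⊆ latticeAt y
    latticeAt-⊆ x y (d≡ , d∣det) {v} m =
      subst₂ (λ r d → Lattice r (r * d) (vector y) v) (component≡⇒scale≡ x y d≡) d≡
        (∣det⇒lattice-⊆ (vector x) (proj₁ (complement x)) (vector y) (proj₂ (complement x))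
          (∣ᵤ⇒∣ {+ component x} {det (vector x) (vector y)} d∣det) {v} m)

    latticeAt-cong : ∀ x y → x ⨆.≈ y → latticeAt x ≐ latticeAt y
    latticeAt-cong x y x≈y =
      (λ {v} → latticeAt-⊆ x y x≈y {v}) , (λ {v} → latticeAt-⊆ y x (⨆.sym {x} {y} x≈y) {v})

    iso : ∀ x H → Member H ≐ latticeAt x → (ℤ² /ᴳ H) ≅ (ℤ/ scale x ℤ ⊕ ℤ/ scale x * component x ℤ)
    iso x = quotient-iso (vector x) (proj₁ (complement x)) (proj₂ (complement x)) (r∣r*s (scale x) (component x))

    subgroupAt : ⨆PF¹-Carrier n → FiniteIndexSubgroup n
    subgroupAt x = H , subst (HasCardinality (AbelianGroup.setoid (ℤ² /ᴳ H))) (index≡ x)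
      (lattice-index {{scale≢0 x}} {{scale*component≢0 x}} (vector x) (proj₁ (complement x)) (proj₂ (complement x))
        (r∣r*s (scale x) (component x)) H ((λ m → m) , (λ m → m)))
      where H = lattice (scale x) (scale x * component x) (vector x)

    latticeForm⇒component : ∀ {P} → LatticeForm P n → Σ (⨆PF¹-Carrier n) λ x → P ≐ latticeAt x
    latticeForm⇒component (r , d , rrd≡n , p , P≐) =
      record { divisor  = ℕD.divides (r * r) (trans (sym rrd≡n) (sym (ℕP.*-assoc r r d)))
             ; isSquare = square r refl
             ; point    = p
             } , P≐

    latticeForm-index : ∀ M → LatticeForm (Member M) n → HasCardinality (AbelianGroup.setoid (ℤ² /ᴳ M)) n
    latticeForm-index M (r , d , rrd≡n , (p , gcd≡1) , M≐) =
      subst (HasCardinality (AbelianGroup.setoid (ℤ² /ᴳ M))) rrd≡n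
        (lattice-index {{ℕP.m*n≢0⇒m≢0 r {{nonZero-≡ rrd≡n}}}} {{ℕP.m*n≢0⇒n≢0 r {{nonZero-≡ rrd≡n}}}}
          p (proj₁ q) (proj₂ q) (r∣r*s r d) M M≐)
      where q = gcd≡1⇒det≡1 (proj₁ p) (proj₂ p) gcd≡1

    hermiteForm⇒latticeForm : ∀ {P} → HermiteForm P n → LatticeForm P n
    hermiteForm⇒latticeForm (c , a , ca≡n , b , P≐) = extend
      (hermite⇒lattice c (toℕ b) a {{ℕP.m*n≢0⇒m≢0 c {{nonZero-≡ ca≡n}}}} {{ℕP.m*n≢0⇒n≢0 c {{nonZero-≡ ca≡n}}}})
      where
      extend : LatticeForm _ (c * a) → LatticeForm _ n
      extend (r , d , rrd≡ca , p , H≐) = r , d , trans rrd≡ca ca≡n , p , ≐-trans P≐ H≐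

-- The bijection.

module _ (n : ℕ) .{{_ : NonZero n}} where

  private module ⨆ = Setoid (⨆PF¹ n)

  -- Opaque, as unfolding the search for generators makes conversion checking intractable.
  abstract
    hermiteForm : (M : FiniteIndexSubgroup n) → HermiteForm (Member (proj₁ M)) n
    hermiteForm (M , index) = normalize (hermite-form M index)
      where
      normalize : (∃ λ m → NonZero m × HermiteForm (Member M) m) → HermiteForm (Member M) n
      -- The lattice form attached to `F` shows that the quotient has `m` elements, and it has `n`
      -- by assumption.
      normalize (m , m≢0 , F) = subst (HermiteForm (Member M))
        (cardinality-unique (latticeForm-index {{m≢0}} M (hermiteForm⇒latticeForm {{m≢0}} F)) index) F

    classify : (M : FiniteIndexSubgroup n) → Σ (⨆PF¹-Carrier n) λ x → Member (proj₁ M) ≐ latticeAt x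
    classify M = latticeForm⇒component (hermiteForm⇒latticeForm (hermiteForm M))

  correspondence : Bijection (subgroupsOfIndex n) (⨆PF¹ n)
  correspondence = record
    { to        = proj₁ ∘ classify
    ; cong      = λ {M} {N} → to-cong {M} {N}
    ; bijective = (λ {M} {N} x≈y → ≐-trans (proj₂ (classify M)) (≐-trans
                     (latticeAt-cong (proj₁ (classify M)) (proj₁ (classify N)) x≈y) (≐-sym (proj₂ (classify N)))))
                , λ x → subgroupAt x , λ {M} M≈ →
                     latticeAt-injective (proj₁ (classify M)) x (≐-trans (≐-sym (proj₂ (classify M))) M≈)
    }
    where
    to-cong : ∀ {M N : FiniteIndexSubgroup n} → Member (proj₁ M) ≐ Member (proj₁ N) → proj₁ (classify M) ⨆.≈ proj₁ (classify N)
    to-cong {M} {N} M≐N = latticeAt-injective (proj₁ (classify M)) (proj₁ (classify N))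
      (≐-trans (≐-sym (proj₂ (classify M))) (≐-trans M≐N (proj₂ (classify N))))

-- Recognising the component from primitive vectors and from the quotient.

module _ {n : ℕ} .{{_ : NonZero n}} where

  scale≡1⇔component≡n : ∀ x → scale x ≡ 1 ⇔ component x ≡ n
  scale≡1⇔component≡n x = mk⇔
    (λ r≡1 → trans (sym (trans (ℕP.*-identityˡ _) (ℕP.*-identityˡ _)))
                   (subst (λ r → r * (r * component x) ≡ n) r≡1 (index≡ x)))
    (λ d≡n → ℕP.m*n≡1⇒m≡1 (scale x) (scale x) (ℕP.*-cancelʳ-≡ _ 1 n
      (trans (ℕP.*-assoc (scale x) (scale x) n)
        (trans (subst (λ d → scale x * (scale x * d) ≡ n) d≡n (index≡ x)) (sym (ℕP.*-identityˡ n))))))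

  module _ (x : ⨆PF¹-Carrier n) (H : Subgroup ℤ² 0ℓ) (H≐ : Member H ≐ latticeAt x) where

    vector∈ : scale x ≡ 1 → Member H (vector x)
    vector∈ r≡1 = proj₂ H≐ {vector x} (subst (latticeAt x)
      (trans (cong (λ r → + r · vector x) r≡1) (cong₂ _,_ (ℤP.*-identityˡ _) (ℤP.*-identityˡ _)))
      (rp∈lattice (scale x) (component x) (vector x)))

    -- The scale divides both coordinates of every member, and for scale 1 the point itself is a
    -- member.
    scale≡1⇔primitive : scale x ≡ 1 ⇔ (∃ λ ((a , b) : ℤ × ℤ) → Member H (a , b) × gcd a b ≡ 1ℤ)
    scale≡1⇔primitive = mk⇔ (λ r≡1 → vector x , vector∈ r≡1 , proj₂ (point x))
      λ ((a , b) , ab∈H , gcd≡1) → let (r∣a , r∣b) , _ = proj₁ H≐ ab∈H in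
        ℕD.∣1⇒≡1 (subst (scale x ∣_) (ℤP.+-injective gcd≡1)
          (ℕG.gcd-greatest (∣⇒∣ᵤ {+ scale x} {a} r∣a) (∣⇒∣ᵤ {+ scale x} {b} r∣b)))

    scale≡1⇔cyclic : scale x ≡ 1 ⇔ Cyclic (ℤ² /ᴳ H)
    scale≡1⇔cyclic = mk⇔
      (λ r≡1 → primitive⇒cyclic H (vector x) (proj₁ (complement x)) (proj₂ (complement x)) (vector∈ r≡1))
      (cyclic⇒r≡1 H {scale x} {scale x * component x} {vector x} (λ {v} → proj₁ H≐ {v}))

    -- The exponent of the quotient recovers `rd`; dividing `n = r (rd)` by it gives `r`, and then
    -- `d`.
    component≡⇔iso : ∀ y → component x ≡ component y ⇔
                     (ℤ² /ᴳ H) ≅ (ℤ/ scale y ℤ ⊕ ℤ/ scale y * component y ℤ)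
    component≡⇔iso y = mk⇔
      (λ d≡ → subst₂ (λ r d → (ℤ² /ᴳ H) ≅ (ℤ/ r ℤ ⊕ ℤ/ r * d ℤ)) (component≡⇒scale≡ x y d≡) d≡ (iso x H H≐))
      (λ ψ → scale≡⇒component≡ x y (same-scale
        (exponent-unique {A = ℤ² /ᴳ H} {scale x} {scale x * component x} {scale y} {scale y * component y}
          (ℕD.m∣m*n (component x)) (ℕD.m∣m*n (component y)) (iso x H H≐) ψ)))
      where
      same-scale : scale x * component x ≡ scale y * component y → scale x ≡ scale y
      same-scale eq = ℕP.*-cancelʳ-≡ _ _ (scale x * component x) {{scale*component≢0 x}}
        (trans (index≡ x) (trans (sym (index≡ y)) (cong (scale y *_) (sym eq))))

root-n*d : ∀ {n d} (d∣n : d ∣ n) (sq : IsSquare (quotient d∣n)) → root (n*d-isSquare d∣n sq) ≡ root sq * d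
root-n*d (ℕD.divides _ refl) (square _ refl) = refl

-- Counting Hermite forms by divisors.

-- σ n counts the pairs (a , b) with a ∣ n and b < a, divisor by divisor.
encode : ∀ {xs a} → a ∈ xs → Fin a → Fin (sum xs)
encode {x ∷ xs} (here refl) b = b ↑ˡ sum xs
encode {x ∷ xs} (there a∈)  b = x ↑ʳ encode a∈ b

encode-surjective : ∀ xs (i : Fin (sum xs)) → ∃₂ λ a (a∈ : a ∈ xs) → ∃ λ b → encode a∈ b ≡ i
encode-surjective (x ∷ xs) i with splitAt x i in eq
... | inj₁ b = x , here refl , b , Fin.splitAt⁻¹-↑ˡ eq
... | inj₂ j with a , a∈ , b , refl ← encode-surjective xs j = a , there a∈ , b , Fin.splitAt⁻¹-↑ʳ eq

↑ˡ≢↑ʳ : ∀ {m n} {i : Fin m} {j : Fin n} → i ↑ˡ n ≡ m ↑ʳ j → ∀ {ℓ} {A : Set ℓ} → A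
↑ˡ≢↑ʳ {m} {n} {i} {j} eq with () ← trans (sym (Fin.splitAt-↑ˡ m i n)) (trans (cong (splitAt m) eq) (Fin.splitAt-↑ʳ m n j))

encode-injective : ∀ {xs a a′} (a∈ : a ∈ xs) (a′∈ : a′ ∈ xs) {b b′} →
                   encode a∈ b ≡ encode a′∈ b′ → a ≡ a′ × toℕ b ≡ toℕ b′
encode-injective {x ∷ xs} (here refl) (here refl)  eq = refl , cong toℕ (Fin.↑ˡ-injective (sum xs) _ _ eq)
encode-injective (here refl) (there a′∈) eq = ↑ˡ≢↑ʳ eq
encode-injective (there a∈)  (here refl) eq = ↑ˡ≢↑ʳ (sym eq)
encode-injective {x ∷ xs} (there a∈)  (there a′∈) eq = encode-injective a∈ a′∈ (Fin.↑ʳ-injective x _ _ eq)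

encode-cong : ∀ {xs a a′} → Unique xs → (a∈ : a ∈ xs) (a′∈ : a′ ∈ xs) {b : Fin a} {b′ : Fin a′} →
              a ≡ a′ → toℕ b ≡ toℕ b′ → encode a∈ b ≡ encode a′∈ b′
encode-cong unique a∈ a′∈ refl b≡b′ = cong₂ encode
  (Membership.unique⇒irrelevant (setoid ℕ) ℕP.≡-irrelevant unique a∈ a′∈) (Fin.toℕ-injective b≡b′)

divisors : ℕ → List ℕ
divisors n = filter (ℕD._∣? n) (map ℕ.suc (upTo n))

divisors-unique : ∀ n → Unique (divisors n)
divisors-unique n = Unique.filter⁺ (ℕD._∣? n) (Unique.map⁺ ℕP.suc-injective (Unique.upTo⁺ n))

∈-divisors⁺ : ∀ {n a} .{{_ : NonZero n}} → a ∣ n → a ∈ divisors n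
∈-divisors⁺ {n} {ℕ.zero}  a∣n = ⊥-elim (ℕ.≢-nonZero⁻¹ n (ℕD.0∣⇒≡0 a∣n))
∈-divisors⁺ {n} {ℕ.suc a} a∣n = ∈-filter⁺ (ℕD._∣? n) (∈-map⁺ ℕ.suc (∈-upTo⁺ (ℕD.∣⇒≤ a∣n))) a∣n

∈-divisors⁻ : ∀ {n a} → a ∈ divisors n → a ∣ n
∈-divisors⁻ {n} a∈ = proj₂ (∈-filter⁻ (ℕD._∣? n) {xs = map ℕ.suc (upTo n)} a∈)

vertical∈hermite : ∀ c b a → Hermite c b a (0ℤ , a)
vertical∈hermite c b a = 0ℤ , 1ℤ , refl , lemma b a
  where
  lemma : ∀ b a → a ≡ 0ℤ ℤ.* b ℤ.+ 1ℤ ℤ.* a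
  lemma = solve-∀

corner∈hermite : ∀ c b a → Hermite c b a (c , b)
corner∈hermite c b a = 1ℤ , 0ℤ , sym (ℤP.*-identityˡ c) , lemma b a
  where
  lemma : ∀ b a → b ≡ 1ℤ ℤ.* b ℤ.+ 0ℤ ℤ.* a
  lemma = solve-∀

-- Tested on `(0 , a)`: the multiple of `(c′ , b′)` must vanish, which leaves a multiple of `a′`.
hermite-⊆⇒∣ : ∀ {c b a c′ b′ a′} .{{_ : NonZero c′}} →
              Hermite (+ c) (+ b) (+ a) ⊆ Hermite (+ c′) (+ b′) (+ a′) → a′ ∣ a
hermite-⊆⇒∣ {c} {b} {a} {c′} {b′} {a′} H⊆ with s , t , 0≡sc′ , a≡ ← H⊆ {0ℤ , + a} (vertical∈hermite (+ c) (+ b) (+ a)) =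
  ∣⇒∣ᵤ {+ a′} {+ a} (Signed.divides t (trans a≡ (trans
    (cong (λ s → s ℤ.* + b′ ℤ.+ t ℤ.* + a′) (ℤP.*-cancelʳ-≡ s 0ℤ (+ c′) (sym 0≡sc′))) (drop (+ b′) (t ℤ.* + a′)))))
  where
  drop : ∀ b a → 0ℤ ℤ.* b ℤ.+ a ≡ a
  drop = solve-∀

-- The entries `a` divide each other and `c = n/a`. Writing `(c , b)` in the other basis then takes
-- `(c , b′)` exactly once, so `b` and `b′` agree modulo `a`.
hermite-injective : ∀ {n c a c′ a′} {b : Fin a} {b′ : Fin a′} .{{_ : NonZero n}} → c * a ≡ n → c′ * a′ ≡ n →
  Hermite (+ c) (+ toℕ b) (+ a) ≐ Hermite (+ c′) (+ toℕ b′) (+ a′) → a ≡ a′ × toℕ b ≡ toℕ b′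
hermite-injective {n} {c} {a} {c′} {a′} {b} {b′} ca≡n c′a′≡n (H⊆ , H⊇) = a≡a′ , same-b a≡a′ c≡c′ H⊆
  where
  instance
    c≢0 : NonZero c
    c≢0 = ℕP.m*n≢0⇒m≢0 c {{nonZero-≡ ca≡n}}
    c′≢0 : NonZero c′
    c′≢0 = ℕP.m*n≢0⇒m≢0 c′ {{nonZero-≡ c′a′≡n}}
    a′≢0 : NonZero a′
    a′≢0 = ℕP.m*n≢0⇒n≢0 c′ {{nonZero-≡ c′a′≡n}}

  a≡a′ : a ≡ a′
  a≡a′ = ℕD.∣-antisym (hermite-⊆⇒∣ {c′} {toℕ b′} {a′} {c} {toℕ b} {a} H⊇)
                      (hermite-⊆⇒∣ {c} {toℕ b} {a} {c′} {toℕ b′} {a′} H⊆)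
  c≡c′ : c ≡ c′
  c≡c′ = ℕP.*-cancelʳ-≡ c c′ a′ (trans (cong (c *_) (sym a≡a′)) (trans ca≡n (sym c′a′≡n)))

  same-b : a ≡ a′ → c ≡ c′ → Hermite (+ c) (+ toℕ b) (+ a) ⊆ Hermite (+ c′) (+ toℕ b′) (+ a′) → toℕ b ≡ toℕ b′
  same-b refl refl H⊆
    with s , t , c≡sc , b≡ ← H⊆ {+ c , + toℕ b} (corner∈hermite (+ c) (+ toℕ b) (+ a)) =
    small-congruent⇒≡ (Fin.toℕ<n b) (Fin.toℕ<n b′) (Signed.divides t (trans (cong (ℤ._- + toℕ b′) (trans b≡
      (cong (λ s → s ℤ.* + toℕ b′ ℤ.+ t ℤ.* + a) (ℤP.*-cancelʳ-≡ s 1ℤ (+ c) (trans (sym c≡sc) (sym (ℤP.*-identityˡ (+ c))))))))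
      (cancel (+ toℕ b′) (t ℤ.* + a))))
    where
    cancel : ∀ b u → (1ℤ ℤ.* b ℤ.+ u) ℤ.- b ≡ u
    cancel = solve-∀

module _ (n : ℕ) .{{_ : NonZero n}} where

  private
    code : ∀ {P} → HermiteForm P n → Fin (σ n)
    code (c , a , ca≡n , b , _) = encode (∈-divisors⁺ (ℕD.divides c (sym ca≡n))) b

    -- The membership proof is arbitrary: `code` builds its own, whereas surjectivity receives one
    -- from `encode-surjective`.
    code-unique : ∀ {P Q : Pred (ℤ × ℤ) 0ℓ} (F : HermiteForm P n) {c a} {b : Fin a} → c * a ≡ n → (a∈ : a ∈ divisors n) →
                  Q ≐ Hermite (+ c) (+ toℕ b) (+ a) → P ≐ Q → code F ≡ encode a∈ b
    code-unique (c′ , a′ , c′a′≡n , b′ , P≐) {c} {a} {b} ca≡n a∈ Q≐ P≐Q =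
      let a≡ , b≡ = hermite-injective {b = b′} {b} c′a′≡n ca≡n (≐-trans (≐-sym P≐) (≐-trans P≐Q Q≐))
      in encode-cong (divisors-unique n) _ a∈ a≡ b≡

    code-cong : ∀ {P Q} (F : HermiteForm P n) (G : HermiteForm Q n) → P ≐ Q → code F ≡ code G
    code-cong F (c , a , ca≡n , b , Q≐) = code-unique F {c} ca≡n _ Q≐

    code-injective : ∀ {P Q} (F : HermiteForm P n) (G : HermiteForm Q n) → code F ≡ code G → P ≐ Q
    code-injective {P} {Q} (c , a , ca≡n , b , P≐) (c′ , a′ , c′a′≡n , b′ , Q≐) eq
      with refl , b≡b′ ← encode-injective (∈-divisors⁺ {n} (ℕD.divides c (sym ca≡n))) (∈-divisors⁺ {n} (ℕD.divides c′ (sym c′a′≡n))) eq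
      with refl ← ℕP.*-cancelʳ-≡ c c′ a {{ℕP.m*n≢0⇒n≢0 c {{nonZero-≡ ca≡n}}}} (trans ca≡n (sym c′a′≡n)) =
      ≐-trans P≐ (subst (λ i → Hermite (+ c) (+ i) (+ a) ≐ Q) (sym b≡b′) (≐-sym Q≐))

  subgroupsOfIndex-cardinality : HasCardinality (subgroupsOfIndex n) (σ n)
  subgroupsOfIndex-cardinality = record
    { to        = λ M → code (hermiteForm n M)
    ; cong      = λ {M} {N} → code-cong (hermiteForm n M) (hermiteForm n N)
    ; bijective = (λ {M} {N} → code-injective (hermiteForm n M) (hermiteForm n N)) , code-surjective
    }
    where
    code-surjective : ∀ i → Σ (FiniteIndexSubgroup n) λ M → ∀ {N : FiniteIndexSubgroup n} →
                      Member (proj₁ N) ≐ Member (proj₁ M) → code (hermiteForm n N) ≡ i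
    code-surjective i
      with a , a∈ , b , refl ← encode-surjective (divisors n) i
      with ℕD.divides c n≡ca ← ∈-divisors⁻ {n} a∈ = subgroupAt (proj₁ x) , λ {N} →
        code-unique (hermiteForm n N) {c} {b = b} (sym n≡ca) a∈ (≐-sym (proj₂ x))
      where
      H = Hermite (+ c) (+ toℕ b) (+ a)
      -- Through its lattice form the span inherits the subgroup structure and the index already
      -- established for lattices.
      x : Σ (⨆PF¹-Carrier n) λ x → H ≐ latticeAt x
      x = latticeForm⇒component (hermiteForm⇒latticeForm (c , a , sym n≡ca , b , (λ h → h) , (λ h → h)))

theorem3p2 : (n : ℕ) .{{_ : NonZero n}} →
    Σ (Bijection (subgroupsOfIndex n) (⨆PF¹ n)) λ Φ →
    let open Bijection Φ using (to) in
    ((M@(H , _) : FiniteIndexSubgroup n) →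
    (component (to M) ≡ n ⇔ (∃ λ ((a , b) : ℤ × ℤ) → Member H (a , b) × gcd a b ≡ 1ℤ))
    × ((∃ λ ((a , b) : ℤ × ℤ) → Member H (a , b) × gcd a b ≡ 1ℤ) ⇔ FiniteCyclic (ℤ² /ᴳ H)))
    × ((d : ℕ) (d∣n : d ∣ n) (sq : IsSquare (quotient d∣n)) (M@(H , _) : FiniteIndexSubgroup n) →
    (component (to M) ≡ d
    ⇔ (ℤ² /ᴳ H) ≅ (ℤ/ root sq ℤ ⊕ ℤ/ root (n*d-isSquare d∣n sq) ℤ)))
    × HasCardinality (subgroupsOfIndex n) (σ n)
theorem3p2 n = correspondence n ,
  (λ M@(H , index) → let x = proj₁ (classify n M); H≐ = proj₂ (classify n M) in
    scale≡1⇔primitive {n} x H H≐ ⇔-∘ ⇔-sym (scale≡1⇔component≡n {n} x) ,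
    -- The index hypothesis is itself the finiteness of the quotient.
    mk⇔ ((n , index) ,_) proj₂ ⇔-∘ (scale≡1⇔cyclic {n} x H H≐ ⇔-∘ ⇔-sym (scale≡1⇔primitive {n} x H H≐))) ,
  (λ d d∣n sq M@(H , _) → let x = proj₁ (classify n M); H≐ = proj₂ (classify n M) in
    subst (λ s → component x ≡ d ⇔ (ℤ² /ᴳ H) ≅ (ℤ/ root sq ℤ ⊕ ℤ/ s ℤ)) (sym (root-n*d d∣n sq))
      -- The point of `x` is borrowed to form an element of component `d` with root `root sq`.
      (component≡⇔iso {n} x H H≐ (record { divisor = d∣n ; isSquare = sq ; point = point x }))) ,
  subgroupsOfIndex-cardinality n
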